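{- Let $m$ be an even positive integer not divisible by $3$. Consider an additive cellular automaton of dimension $2$ over $\mathbb{Z}/m\mathbb{Z}$ with weight array $W=(w_j)_{j\in[-r,r]^2}$ such that $\sigma=\sum_j w_j$ is invertible in $\mathbb{Z}/m\mathbb{Z}$ and $\sigma\equiv 1\pmod{2^{v_2(m)}}$. Let $a\in\mathbb{Z}/m\mathbb{Z}$, $d=(d_1,d_2)\in(\mathbb{Z}/m\mathbb{Z})^2$ and $\varepsilon\in\{ -1,1\}^3$, and put $d_3:=\sigma^{ -1}(\sigma_1d_1+\sigma_2d_2)$. Suppose that $\varepsilon_2d_2$, $\varepsilon_3d_3$, $\varepsilon_2d_2-\varepsilon_1d_1$ and $\varepsilon_1d_1-\varepsilon_3d_3$ are invertible in $\mathbb{Z}/m\mathbb{Z}$ and that $\gcd(\varepsilon_1d_1,m)=\gcd(\varepsilon_3d_3-\varepsilon_2d_2,m)=2$. Then, in the orbit $\mathcal{O}(\mathrm{AA}(a,d))$, every tetrahedron with orientation $\varepsilon$ and of size $s$ is balanced, for all positive integers $s\equiv 0$ or $-2\pmod{\mathrm{lcm}(\mathrm{ord}_m(\sigma),m)}$.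
   Context: $v_2(m)$ is the largest $u$ with $2^u\mid m$. An additive cellular automaton of dimension $2$ with integer weight array $W=(w_j)_{j\in[-r,r]^2}$ maps an array $(a_i)_{i\in\mathbb{Z}^2}$ of $\mathbb{Z}/m\mathbb{Z}$ to $\left(\sum_j w_ja_{i+j}\right)_{i\in\mathbb{Z}^2}$; $\sigma=\sum_jw_j$, $\sigma_k=\sum_j j_kw_j$ ($k=1,2$). The orbit $\mathcal{O}(A)$ is the array $(a_{i,j})_{(i,j)\in\mathbb{Z}^2\times\mathbb{N}}$ whose $j$-th row is $\partial^j(A)$. $\mathrm{AA}(a,d)=(a+i_1d_1+i_2d_2)_{i\in\mathbb{Z}^2}$. The tetrahedron with principal vertex $j$, orientation $\varepsilon$ and size $s$ in this array is the multiset $\{a_{j+\varepsilon\cdot k}: k\in\mathbb{N}^3,\ k_1+k_2+k_3\le s-1\}$ ($\varepsilon\cdot k$ componentwise product; all indices required to lie in $\mathbb{Z}^2\times\mathbb{N}$). Balanced means every element of $\mathbb{Z}/m\mathbb{Z}$ occurs with the same multiplicity. $\mathrm{ord}_m(\sigma)$ is the multiplicative order of $\sigma$ modulo $m$; $\gcd(x,m)$ for $x\in\mathbb{Z}/m\mathbb{Z}$ uses any representative. -}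

module Defs where

open import Data.Nat as ℕ using (ℕ; zero; suc; NonZero)
open import Data.Integer as ℤ using (ℤ; +_; -_; _+_; _-_; _*_; _^_; ∣_∣; _%ℕ_)
open import Data.Integer.Divisibility as ℤD using ()
open import Data.Nat.Divisibility as ℕD using ()
open import Data.List using (List; []; _∷_; map; concatMap; upTo; foldr; length; filter)
open import Data.Fin using (Fin; toℕ)
open import Data.Product using (Σ; _×_)
open import Relation.Binary.PropositionalEquality using (_≡_)
open import Relation.Nullary using (¬_)

-- Congruence modulo m of integer representatives of ℤ/mℤ.
_≡[_]_ : ℤ → ℕ → ℤ → Set
x ≡[ m ] y = (+ m) ℤD.∣ (x - y)

Invertible : ℕ → ℤ → Set
Invertible m x = Σ ℤ (λ y → (x * y) ≡[ m ] (+ 1))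

IsV2 : ℕ → ℕ → Set
IsV2 m u = (2 ℕ.^ u) ℕD.∣ m × ¬ ((2 ℕ.^ suc u) ℕD.∣ m)

IsOrd : ℕ → ℤ → ℕ → Set
IsOrd m σ o = (0 ℕ.< o) × ((σ ^ o) ≡[ m ] (+ 1))
              × (∀ k → 0 ℕ.< k → k ℕ.< o → ¬ ((σ ^ k) ≡[ m ] (+ 1)))

IsSign : ℤ → Set
IsSign e = (e ≡ + 1) Data.Sum.⊎ (e ≡ - (+ 1))
  where import Data.Sum

window : ℕ → List ℤ
window r = map (λ i → + i - + r) (upTo (suc (2 ℕ.* r)))

-- weight array W = (w_j)_{j ∈ [-r,r]^2}, given as a function on ℤ² (only values on the window matter)
Weights : Set
Weights = ℤ → ℤ → ℤ

Array : Set
Array = ℤ → ℤ → ℤ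

sumWin : ℕ → (ℤ → ℤ → ℤ) → ℤ
sumWin r f = foldr _+_ (+ 0) (concatMap (λ j₁ → map (λ j₂ → f j₁ j₂) (window r)) (window r))

σ₀ : ℕ → Weights → ℤ
σ₀ r W = sumWin r W

σ₁ : ℕ → Weights → ℤ
σ₁ r W = sumWin r (λ j₁ j₂ → j₁ * W j₁ j₂)

σ₂ : ℕ → Weights → ℤ
σ₂ r W = sumWin r (λ j₁ j₂ → j₂ * W j₁ j₂)

-- the additive cellular automaton ∂ (computed on integer representatives)
step : ℕ → Weights → Array → Array
step r W A i₁ i₂ = sumWin r (λ j₁ j₂ → W j₁ j₂ * A (i₁ + j₁) (i₂ + j₂))

orbit : ℕ → Weights → Array → ℤ → ℤ → ℕ → ℤ
orbit r W A i₁ i₂ zero = A i₁ i₂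
orbit r W A i₁ i₂ (suc t) = step r W (λ x y → orbit r W A x y t) i₁ i₂

AA : ℤ → ℤ → ℤ → Array
AA a d₁ d₂ i₁ i₂ = a + i₁ * d₁ + i₂ * d₂

record ℕ³ : Set where
  constructor k3
  field k₁ k₂ k₃ : ℕ

simplex : ℕ → List ℕ³
simplex s = concatMap (λ a → concatMap (λ b → map (λ c → k3 a b c)
              (upTo (s ℕ.∸ a ℕ.∸ b))) (upTo (s ℕ.∸ a))) (upTo s)

-- the tetrahedron with principal vertex (j₁,j₂,t), orientation (ε₁,ε₂,ε₃), size s
-- (time index ∣ t + ε₃ k₃ ∣ ; meaningful when all these are ≥ 0, see InArray)
tetrahedron : ℕ → Weights → Array → ℤ → ℤ → ℤ → ℤ → ℤ → ℕ → ℕ → List ℤ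
tetrahedron r W A ε₁ ε₂ ε₃ j₁ j₂ t s =
  map (λ k → orbit r W A (j₁ + ε₁ * + ℕ³.k₁ k) (j₂ + ε₂ * + ℕ³.k₂ k)
               ∣ + t + ε₃ * + ℕ³.k₃ k ∣)
      (simplex s)

InArray : ℤ → ℕ → ℕ → Set
InArray ε₃ t s = ∀ k₃ → k₃ ℕ.< s → + 0 ℤ.≤ + t + ε₃ * + k₃

mult : (m : ℕ) .{{_ : NonZero m}} → List ℤ → Fin m → ℕ
mult m l c = length (filter (λ x → (x %ℕ m) ℕ.≟ toℕ c) l)

Balanced : (m : ℕ) .{{_ : NonZero m}} → List ℤ → Set
Balanced m l = ∀ c c' → mult m l c ≡ mult m l c'

{-# OPTIONS --safe #-}
module Submission where

open import Defs
open import Data.Nat as ℕ using (ℕ; zero; suc; NonZero; _<_)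
import Data.Nat.Properties as ℕ
import Data.Nat.DivMod as ℕ
import Data.Nat.Divisibility as ℕ
import Data.Nat.GCD as ℕ
open import Data.Nat.Divisibility using (_∣_; divides)
open import Data.Nat.Induction using (<-wellFounded)
open import Data.Nat.LCM using (lcm; m∣lcm[m,n]; n∣lcm[m,n])
open import Data.Integer as ℤ using (ℤ; +_; _+_; _-_; _*_; -_; _^_; _%ℕ_; _/ℕ_)
import Data.Integer.Properties as ℤ
import Data.Integer.DivMod as ℤ
import Data.Integer.Divisibility.Signed as Signed
open import Data.Integer.GCD as ℤG using ()
open import Data.Integer.Tactic.RingSolver using (solve-∀)
open import Algebra.Properties.AbelianGroup ℤ.+-0-abelianGroup using () renaming (∙-cancelˡ to +-cancelˡ)
open import Data.Bool using (if_then_else_; true; false)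
open import Data.Empty using (⊥-elim)
open import Data.Fin as Fin using (Fin; fromℕ<; toℕ)
import Data.Fin.Properties as Fin
open import Data.List using (List; []; _∷_; _++_; map; concatMap; upTo; applyUpTo; foldr; filter; length)
open import Data.Product using (∃; ∃₂; _×_; _,_; proj₁)
open import Data.Sum using (_⊎_; inj₁; inj₂)
open import Function using (_∘_; id; mk⇔)
open import Induction.WellFounded using (Acc; acc)
open import Relation.Nullary using (¬_; yes; no; does; contradiction)
open import Relation.Nullary.Decidable using (does-⇔)
open import Relation.Unary using (Decidable)
open import Relation.Binary.PropositionalEquality
open ≡-Reasoning

-- Modulo m the entry of the tetrahedron at k is ρᶜ(A + a e₁ + b e₂ + c e₃) with k = (a, b, c), where
-- ρ = σ^ε₃ and eᵢ = σᵗεᵢdᵢ; each of e₁, e₂, e₃ and their differences divides 2 modulo m.  A multiset is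
-- balanced iff its sum of φ is unchanged when φ is translated by 1, for every m-periodic φ.
--
-- Translation by 2.  Put ψ(x) = φ(x + 2) − φ(x), so ψ sums to 0 over any full progression whose step
-- divides 2.  Hence ψ has an antidifference up to the factor m: m ψ(x) = η(x + e) − η(x) for
-- η(x) = Σⱼ j ψ(x + je).  Doing this for e₁ − e₂, e₂ and e₁ writes m³ψ, up to a translation, as
-- (X − 1)(Y − 1)(X − Y)η with X, Y the translations by e₁, e₂, and then the sum of ψ over each horizontal
-- triangle collapses to six terms near its corners.  As c varies these run along the lines of steps e₃, e₃ − e₁ and e₃ − e₂, and the
-- layers c = s and c = s + 1 contribute nothing; so it remains to treat the lines c ↦ ρᶜ(B + cδ) over a
-- common period N of c and ρᶜ.
--
-- Such a line modulo Un, where U = 2ᵘ is the 2-part of m and n is odd: some 0 < p < n has ρᵖ ≡ 1 modulo n,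
-- hence modulo Un since ρ ≡ 1 modulo U.  The line is then invariant under translation by pδ, so by U gcd(p, n),
-- and one descends to n replaced by gcd(p, n) < n until n = 1, where p = 1 works.
--
-- Translation by 1.  By averaging, φ may now be taken 2-periodic; modulo 2 the entry at k is A + b + c, and
-- the alternating sums over triangles of consecutive sizes cancel in pairs because s is even.

-- Congruences between integers.

-- A record rather than the divisibility statement, so that x and y are inferable.
infix 4 _≋_mod_
record _≋_mod_ (x y D : ℤ) : Set where
  constructor mod-by
  field
    quotient : ℤ
    equality : x ≡ y + quotient * D

module _ {D : ℤ} where

  ≋-reflexive : ∀ {x y} → x ≡ y → x ≋ y mod D
  ≋-reflexive {x} refl = mod-by (+ 0) (lemma x D)
    where
    lemma : ∀ x d → x ≡ x + + 0 * d
    lemma = solve-∀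

  ≋-refl : ∀ {x} → x ≋ x mod D
  ≋-refl = ≋-reflexive refl

  ≋-sym : ∀ {x y} → x ≋ y mod D → y ≋ x mod D
  ≋-sym {y = y} (mod-by q eq) =
    mod-by (- q) (trans (lemma y q D) (cong (λ z → z + - q * D) (sym eq)))
    where
    lemma : ∀ y q d → y ≡ y + q * d + - q * d
    lemma = solve-∀

  ≋-trans : ∀ {x y z} → x ≋ y mod D → y ≋ z mod D → x ≋ z mod D
  ≋-trans {z = z} (mod-by q refl) (mod-by p refl) = mod-by (p + q) (lemma z p q D)
    where
    lemma : ∀ z p q d → z + p * d + q * d ≡ z + (p + q) * d
    lemma = solve-∀

  +-cong-mod : ∀ {x y u v} → x ≋ y mod D → u ≋ v mod D → x + u ≋ y + v mod D
  +-cong-mod {y = y} {v = v} (mod-by q refl) (mod-by p refl) = mod-by (q + p) (lemma y v q p D)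
    where
    lemma : ∀ y v q p d → y + q * d + (v + p * d) ≡ y + v + (q + p) * d
    lemma = solve-∀

  *-cong-mod : ∀ {x y u v} → x ≋ y mod D → u ≋ v mod D → x * u ≋ y * v mod D
  *-cong-mod {y = y} {v = v} (mod-by q refl) (mod-by p refl) =
    mod-by (q * v + y * p + q * p * D) (lemma y v q p D)
    where
    lemma : ∀ y v q p d → (y + q * d) * (v + p * d) ≡ y * v + (q * v + y * p + q * p * d) * d
    lemma = solve-∀

  +-congˡ-mod : ∀ z {x y} → x ≋ y mod D → z + x ≋ z + y mod D
  +-congˡ-mod z = +-cong-mod (≋-refl {x = z})

  +-congʳ-mod : ∀ z {x y} → x ≋ y mod D → x + z ≋ y + z mod D
  +-congʳ-mod z x≋y = +-cong-mod x≋y (≋-refl {x = z})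

  *-congˡ-mod : ∀ z {x y} → x ≋ y mod D → z * x ≋ z * y mod D
  *-congˡ-mod z = *-cong-mod (≋-refl {x = z})

  *-congʳ-mod : ∀ z {x y} → x ≋ y mod D → x * z ≋ y * z mod D
  *-congʳ-mod z x≋y = *-cong-mod x≋y (≋-refl {x = z})

  ^-cong-mod : ∀ {x y} n → x ≋ y mod D → x ^ n ≋ y ^ n mod D
  ^-cong-mod zero    x≋y = ≋-refl
  ^-cong-mod (suc n) x≋y = *-cong-mod x≋y (^-cong-mod n x≋y)

  ^≋1 : ∀ {x} n → x ≋ + 1 mod D → x ^ n ≋ + 1 mod D
  ^≋1 n x≋1 = ≋-trans (^-cong-mod n x≋1) (≋-reflexive (ℤ.^-zeroˡ n))

  infixr 4 _≡then≋_ _≋then≡_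
  _≡then≋_ : ∀ {x y z} → x ≡ y → y ≋ z mod D → x ≋ z mod D
  refl ≡then≋ p = p

  _≋then≡_ : ∀ {x y z} → x ≋ y mod D → y ≡ z → x ≋ z mod D
  p ≋then≡ refl = p

  multiple≋0 : ∀ q → q * D ≋ + 0 mod D
  multiple≋0 q = mod-by q (lemma (q * D))
    where
    lemma : ∀ x → x ≡ + 0 + x
    lemma = solve-∀

≋-divisor : ∀ {D q x y} → x ≋ y mod (q * D) → x ≋ y mod D
≋-divisor {D} {q} {y = y} (mod-by p refl) = mod-by (p * q) (lemma y p q D)
  where
  lemma : ∀ y p q d → y + p * (q * d) ≡ y + p * q * d
  lemma = solve-∀

^-inverse : ∀ {D ρ ρ⁻¹} → ρ * ρ⁻¹ ≋ + 1 mod D → ∀ k → ρ ^ k * ρ⁻¹ ^ k ≋ + 1 mod D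
^-inverse ρρ⁻¹ zero = ≋-refl
^-inverse {ρ = ρ} {ρ⁻¹} ρρ⁻¹ (suc k) =
  lemma ρ ρ⁻¹ (ρ ^ k) (ρ⁻¹ ^ k) ≡then≋ *-cong-mod ρρ⁻¹ (^-inverse ρρ⁻¹ k)
  where
  lemma : ∀ a b c d → a * c * (b * d) ≡ a * b * (c * d)
  lemma = solve-∀

-- Finite sums

∑ : ℕ → (ℕ → ℤ) → ℤ
∑ zero    f = + 0
∑ (suc n) f = f 0 + ∑ n (f ∘ suc)

∑-cong< : ∀ n {f g} → (∀ i → i < n → f i ≡ g i) → ∑ n f ≡ ∑ n g
∑-cong< zero    f≡g = refl
∑-cong< (suc n) f≡g = cong₂ _+_ (f≡g 0 ℕ.z<s) (∑-cong< n λ i i<n → f≡g (suc i) (ℕ.s<s i<n))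

∑-cong : ∀ n {f g} → (∀ i → f i ≡ g i) → ∑ n f ≡ ∑ n g
∑-cong n f≡g = ∑-cong< n λ i _ → f≡g i

∑-0 : ∀ n → ∑ n (λ _ → + 0) ≡ + 0
∑-0 zero    = refl
∑-0 (suc n) = trans (ℤ.+-identityˡ _) (∑-0 n)

∑-zero< : ∀ n {f} → (∀ i → i < n → f i ≡ + 0) → ∑ n f ≡ + 0
∑-zero< n f≡0 = trans (∑-cong< n f≡0) (∑-0 n)

∑-zero : ∀ n {f} → (∀ i → f i ≡ + 0) → ∑ n f ≡ + 0
∑-zero n f≡0 = ∑-zero< n λ i _ → f≡0 i

+-interchange : ∀ a b c d → a + b + (c + d) ≡ a + c + (b + d)
+-interchange = solve-∀

∑-+ : ∀ n f g → ∑ n (λ i → f i + g i) ≡ ∑ n f + ∑ n g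
∑-+ zero    f g = refl
∑-+ (suc n) f g =
  trans (cong (λ z → f 0 + g 0 + z) (∑-+ n (f ∘ suc) (g ∘ suc)))
        (+-interchange (f 0) (g 0) (∑ n (f ∘ suc)) (∑ n (g ∘ suc)))

∑-*ˡ : ∀ n c f → ∑ n (λ i → c * f i) ≡ c * ∑ n f
∑-*ˡ zero    c f = sym (ℤ.*-zeroʳ c)
∑-*ˡ (suc n) c f =
  trans (cong (λ z → c * f 0 + z) (∑-*ˡ n c (f ∘ suc))) (sym (ℤ.*-distribˡ-+ c (f 0) (∑ n (f ∘ suc))))

∑-neg : ∀ n f → ∑ n (λ i → - f i) ≡ - ∑ n f
∑-neg zero    f = refl
∑-neg (suc n) f =
  trans (cong (λ z → - f 0 + z) (∑-neg n (f ∘ suc))) (sym (ℤ.neg-distrib-+ (f 0) (∑ n (f ∘ suc))))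

∑-- : ∀ n f g → ∑ n (λ i → f i - g i) ≡ ∑ n f - ∑ n g
∑-- n f g = trans (∑-+ n f (-_ ∘ g)) (cong (λ z → ∑ n f + z) (∑-neg n g))

∑-const : ∀ n c → ∑ n (λ _ → c) ≡ + n * c
∑-const zero    c = refl
∑-const (suc n) c = begin
  c + ∑ n (λ _ → c)  ≡⟨ cong (λ z → c + z) (∑-const n c) ⟩
  c + + n * c        ≡⟨ lemma c (+ n) ⟩
  (+ 1 + + n) * c    ∎
  where
  lemma : ∀ c k → c + k * c ≡ (+ 1 + k) * c
  lemma = solve-∀

∑-last : ∀ n f → ∑ (suc n) f ≡ ∑ n f + f n
∑-last zero    f = ℤ.+-comm (f 0) (+ 0)
∑-last (suc n) f =
  trans (cong (λ z → f 0 + z) (∑-last n (f ∘ suc))) (sym (ℤ.+-assoc (f 0) (∑ n (f ∘ suc)) (f (suc n))))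

∑-comm : ∀ m n (f : ℕ → ℕ → ℤ) → ∑ m (λ i → ∑ n (f i)) ≡ ∑ n (λ j → ∑ m (λ i → f i j))
∑-comm zero    n f = sym (∑-0 n)
∑-comm (suc m) n f =
  trans (cong (λ z → ∑ n (f 0) + z) (∑-comm m n (f ∘ suc)))
        (sym (∑-+ n (f 0) (λ j → ∑ m (λ i → f (suc i) j))))

∑-suc-periodic : ∀ n f → f n ≡ f 0 → ∑ n (f ∘ suc) ≡ ∑ n f
∑-suc-periodic n f fn≡f0 =
  +-cancelˡ (f 0) (∑ n (f ∘ suc)) (∑ n f)
    (trans (∑-last n f) (trans (cong (λ z → ∑ n f + z) fn≡f0) (ℤ.+-comm (∑ n f) (f 0))))

-- Periodic functions and sums over a full period.

Periodic : ℤ → (ℤ → ℤ) → Set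
Periodic D φ = ∀ {x y} → x ≋ y mod D → φ x ≡ φ y

shift : ℤ → (ℤ → ℤ) → ℤ → ℤ
shift h φ x = φ (x + h)

shift-periodic : ∀ {D φ} h → Periodic D φ → Periodic D (shift h φ)
shift-periodic h per x≋y = per (+-congʳ-mod h x≋y)

∑-+ℕ-periodic : ∀ n f → (∀ k → f (n ℕ.+ k) ≡ f k) → ∀ a → ∑ n (λ i → f (i ℕ.+ a)) ≡ ∑ n f
∑-+ℕ-periodic n f per zero    = ∑-cong n λ i → cong f (ℕ.+-identityʳ i)
∑-+ℕ-periodic n f per (suc a) = begin
  ∑ n (λ i → f (i ℕ.+ suc a))  ≡⟨ ∑-cong n (λ i → cong f (ℕ.+-suc i a)) ⟩
  ∑ n (λ i → f (suc i ℕ.+ a))  ≡⟨ ∑-suc-periodic n (λ i → f (i ℕ.+ a)) (per a) ⟩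
  ∑ n (λ i → f (i ℕ.+ a))      ≡⟨ ∑-+ℕ-periodic n f per a ⟩
  ∑ n f                        ∎

∑-shift-periodic : ∀ n (G : ℤ → ℤ) → Periodic (+ n) G →
  ∀ z → ∑ n (λ i → G (+ i + z)) ≡ ∑ n (λ i → G (+ i))
∑-shift-periodic n G per (+ a) =
  ∑-+ℕ-periodic n (G ∘ +_) (λ k → per (mod-by (+ 1) (lemma (+ n) (+ k)))) a
  where
  lemma : ∀ n k → n + k ≡ k + + 1 * n
  lemma = solve-∀
-- Here `- z` is positive, so the previous clause applies to the translate of `G` by `z`, and the
-- two translations cancel.
∑-shift-periodic n G per z@(ℤ.-[1+ b ]) = begin
  ∑ n (λ i → G (+ i + z))                    ≡⟨ ∑-shift-periodic n (shift z G) (shift-periodic z per) (- z) ⟨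
  ∑ n (λ i → G (+ i + - z + z))              ≡⟨ ∑-cong n (λ i → cong G (lemma (+ i) z)) ⟩
  ∑ n (λ i → G (+ i))                        ∎
  where
  lemma : ∀ i z → i + - z + z ≡ i
  lemma = solve-∀

-- Residues and units

≋-% : ∀ x n .{{_ : NonZero n}} → x ≋ + (x %ℕ n) mod + n
≋-% x n = mod-by (x /ℕ n) (ℤ.a≡a%ℕn+[a/ℕn]*n x n)

modulus≤ : ∀ {r s n} k → + r ≡ + s + + suc k * + n → n ℕ.≤ r
modulus≤ {r} {s} {n} k eq = ℕ.≤-trans (ℕ.m≤n+m n s)
  (ℕ.≤-trans (ℕ.+-monoʳ-≤ s (ℕ.m≤m+n n (k ℕ.* n)))
    (ℕ.≤-reflexive (sym (ℤ.+-injective (trans eq (cong (λ z → + s + z) (sym (ℤ.pos-* (suc k) n))))))))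

-- A nonzero quotient would force the larger of the two residues to be at least `n`.
residue-unique : ∀ {r s n} → r < n → s < n → + r ≋ + s mod + n → r ≡ s
residue-unique {s = s} {n} r<n s<n (mod-by (+ zero) eq) =
  ℤ.+-injective (trans eq (ℤ.+-identityʳ (+ s)))
residue-unique r<n s<n (mod-by (+ suc k) eq) = ⊥-elim (ℕ.<⇒≱ r<n (modulus≤ k eq))
residue-unique r<n s<n p@(mod-by (ℤ.-[1+ k ]) _) =
  ⊥-elim (ℕ.<⇒≱ s<n (modulus≤ k (_≋_mod_.equality (≋-sym p))))

≋⇒%≡ : ∀ {x y} n .{{_ : NonZero n}} → x ≋ y mod + n → x %ℕ n ≡ y %ℕ n
≋⇒%≡ {x} {y} n x≋y = residue-unique (ℤ.n%ℕd<d x n) (ℤ.n%ℕd<d y n)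
  (≋-trans (≋-sym (≋-% x n)) (≋-trans x≋y (≋-% y n)))

-- The coefficient of `n` disappears into the modulus, so both sign patterns of the Bézout identity
-- give a congruence of the same shape.
bezout : ∀ m n → ∃ λ x → + ℕ.gcd m n ≋ x * + m mod + n
bezout m n with ℕ.Bézout.identity (ℕ.gcd-GCD m n)
... | ℕ.Bézout.+- x y eq = + x , ≋-sym (mod-by (+ y) (begin
  + x * + m              ≡⟨ ℤ.pos-* x m ⟨
  + (x ℕ.* m)            ≡⟨ cong +_ eq ⟨
  + d + + (y ℕ.* n)      ≡⟨ cong (λ z → + d + z) (ℤ.pos-* y n) ⟩
  + d + + y * + n        ∎))
  where d = ℕ.gcd m n
... | ℕ.Bézout.-+ x y eq = - (+ x) , mod-by (+ y) (begin
  + d                                    ≡⟨ lemma (+ d) (+ x) (+ m) ⟩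
  - (+ x) * + m + (+ d + + x * + m)      ≡⟨ cong (λ z → - (+ x) * + m + (+ d + z)) (ℤ.pos-* x m) ⟨
  - (+ x) * + m + + (d ℕ.+ x ℕ.* m)      ≡⟨ cong (λ z → - (+ x) * + m + + z) eq ⟩
  - (+ x) * + m + + (y ℕ.* n)            ≡⟨ cong (λ z → - (+ x) * + m + z) (ℤ.pos-* y n) ⟩
  - (+ x) * + m + + y * + n              ∎)
  where
  d = ℕ.gcd m n
  lemma : ∀ d x m → d ≡ - x * m + (d + x * m)
  lemma = solve-∀

-- Write c - 1 = aU = bn and 1 = xU - qn. Then c - 1 = aU(xU - qn) = (bx - aq)Un.
crt-1 : ∀ {U n x c} → x * U ≋ + 1 mod n → c ≋ + 1 mod U → c ≋ + 1 mod n → c ≋ + 1 mod (U * n)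
crt-1 {U} {n} {x} {c} (mod-by q xU) (mod-by a cU) (mod-by b cn) = mod-by (b * x - a * q) (begin
  c                                                        ≡⟨ cU ⟩
  + 1 + a * U                                              ≡⟨ lemma₁ a U (q * n) ⟩
  + 1 + a * U * (+ 1 + q * n - q * n)                      ≡⟨ cong (λ z → + 1 + a * U * (z - q * n)) xU ⟨
  + 1 + a * U * (x * U - q * n)                            ≡⟨ lemma₂ a U (x * U) q n ⟩
  + 1 + (a * U * (x * U) - a * q * (U * n))                ≡⟨ cong (λ z → + 1 + (z * (x * U) - a * q * (U * n))) aU≡bn ⟩
  + 1 + (b * n * (x * U) - a * q * (U * n))                ≡⟨ lemma₃ a b x U q n ⟩
  + 1 + (b * x - a * q) * (U * n)                          ∎)
  where
  aU≡bn : a * U ≡ b * n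
  aU≡bn = +-cancelˡ (+ 1) (a * U) (b * n) (trans (sym cU) cn)
  lemma₁ : ∀ a U z → + 1 + a * U ≡ + 1 + a * U * (+ 1 + z - z)
  lemma₁ = solve-∀
  lemma₂ : ∀ a U z q n → + 1 + a * U * (z - q * n) ≡ + 1 + (a * U * z - a * q * (U * n))
  lemma₂ = solve-∀
  lemma₃ : ∀ a b x U q n → + 1 + (b * n * (x * U) - a * q * (U * n)) ≡ + 1 + (b * x - a * q) * (U * n)
  lemma₃ = solve-∀

^-cancel : ∀ {D ρ ρ⁻¹} → ρ * ρ⁻¹ ≋ + 1 mod D → ∀ i j → ρ ^ (i ℕ.+ j) ≋ ρ ^ i mod D → ρ ^ j ≋ + 1 mod D
^-cancel {D} {ρ} {ρ⁻¹} inv i j eq =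
  ≋-trans (≋-sym (*-cong-mod (^-inverse inv i) (≋-refl {x = ρ ^ j})
            ≋then≡ ℤ.*-identityˡ (ρ ^ j)))
  (lemma (ρ ^ i) (ρ⁻¹ ^ i) (ρ ^ j)
   ≡then≋ *-cong-mod (sym (ℤ.^-distribˡ-+-* ρ i j) ≡then≋ eq) ≋-refl
   ≋-∙ ^-inverse inv i)
  where
  infixr 3 _≋-∙_
  _≋-∙_ = ≋-trans
  lemma : ∀ a b c → a * b * c ≡ a * c * b
  lemma = solve-∀

1≋0⇒≡1 : ∀ {n} → + 1 ≋ + 0 mod + n → n ≡ 1
1≋0⇒≡1 {n} (mod-by q eq) = ℕ.m*n≡1⇒n≡1 ℤ.∣ q ∣ n
  (trans (sym (ℤ.abs-* q (+ n))) (cong ℤ.∣_∣ (trans (sym (ℤ.+-identityˡ (q * + n))) (sym eq))))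

-- Powers of a unit avoid the residue 0, so two of the first n ones coincide.
small-period : ∀ {ρ ρ⁻¹} n → 1 < n → ρ * ρ⁻¹ ≋ + 1 mod + n →
  ∃ λ p → 0 < p × p < n × ρ ^ p ≋ + 1 mod + n
small-period 1 (ℕ.s<s ()) inv
small-period {ρ} {ρ⁻¹} n@(suc (suc k)) 1<n inv = collision (Fin.pigeonhole (ℕ.n<1+n (suc k)) f)
  where
  residue : ℕ → ℕ
  residue i = ρ ^ i %ℕ n

  residue-nonZero : ∀ i → NonZero (residue i)
  residue-nonZero i = ℕ.≢-nonZero λ r≡0 →
    ℕ.<⇒≢ 1<n (sym (1≋0⇒≡1 (≋-trans (≋-sym (^-inverse inv i))
      (*-cong-mod (≋-% (ρ ^ i) n ≋then≡ cong +_ r≡0) (≋-refl {x = ρ⁻¹ ^ i})))))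

  pred-residue< : ∀ i → ℕ.pred (residue i) < suc k
  pred-residue< i = ℕ.pred-mono-≤ (ℕ.≤-trans
    (ℕ.≤-reflexive (cong suc (ℕ.suc-pred (residue i) {{residue-nonZero i}})))
    (ℤ.n%ℕd<d (ρ ^ i) n))

  -- Nonzero residues are lowered by one, so that the n exponents 0, ..., n - 1 share n - 1
  -- pigeonholes; a collision then has an exponent difference below n.
  f : Fin n → Fin (suc k)
  f i = fromℕ< (pred-residue< (toℕ i))

  f-injective : ∀ i j → f i ≡ f j → residue (toℕ i) ≡ residue (toℕ j)
  f-injective i j eq = ℕ.pred-injective {{residue-nonZero (toℕ i)}} {{residue-nonZero (toℕ j)}}
    (trans (sym (Fin.toℕ-fromℕ< (pred-residue< (toℕ i))))
      (trans (cong toℕ eq) (Fin.toℕ-fromℕ< (pred-residue< (toℕ j)))))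

  residue≡⇒≋ : ∀ i j → residue i ≡ residue j → ρ ^ i ≋ ρ ^ j mod + n
  residue≡⇒≋ i j eq = ≋-trans (≋-% (ρ ^ i) n ≋then≡ cong +_ eq) (≋-sym (≋-% (ρ ^ j) n))

  collision : (∃₂ λ i j → i Fin.< j × f i ≡ f j) → ∃ λ p → 0 < p × p < n × ρ ^ p ≋ + 1 mod + n
  collision (i , j , i<j , fi≡fj) =
    toℕ j ℕ.∸ toℕ i , ℕ.m<n⇒0<n∸m i<j , ℕ.≤-<-trans (ℕ.m∸n≤m (toℕ j) (toℕ i)) (Fin.toℕ<n j)
    , ^-cancel inv (toℕ i) (toℕ j ℕ.∸ toℕ i)
       (cong (ρ ^_) (ℕ.m+[n∸m]≡n (ℕ.<⇒≤ i<j)) ≡then≋ ≋-sym (residue≡⇒≋ (toℕ i) (toℕ j) (f-injective i j fi≡fj)))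

-- Sums of periodic functions over multisets

total : List ℤ → (ℤ → ℤ) → ℤ
total []       φ = + 0
total (x ∷ xs) φ = φ x + total xs φ

total-cong : ∀ xs {φ ψ} → (∀ x → φ x ≡ ψ x) → total xs φ ≡ total xs ψ
total-cong []       φ≡ψ = refl
total-cong (x ∷ xs) φ≡ψ = cong₂ _+_ (φ≡ψ x) (total-cong xs φ≡ψ)

total-∑ : ∀ xs n (φ : ℕ → ℤ → ℤ) → total xs (λ x → ∑ n (λ j → φ j x)) ≡ ∑ n (λ j → total xs (φ j))
total-∑ []       n φ = sym (∑-0 n)
total-∑ (x ∷ xs) n φ =
  trans (cong (λ z → ∑ n (λ j → φ j x) + z) (total-∑ xs n φ))
        (sym (∑-+ n (λ j → φ j x) (λ j → total xs (φ j))))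

total-applyUpTo : ∀ v n φ → total (applyUpTo v n) φ ≡ ∑ n (φ ∘ v)
total-applyUpTo v zero    φ = refl
total-applyUpTo v (suc n) φ = cong (λ z → φ (v 0) + z) (total-applyUpTo (v ∘ suc) n φ)

-- Agreement of a multiset with its translate modulo `D` is tested on integer-valued functions, so
-- that averages and antidifferences can be formed on the functions while the multiset stays fixed.
record Invariant (xs : List ℤ) (D h : ℤ) : Set where
  constructor invariant
  field
    invariance : ∀ φ → Periodic D φ → total xs (shift h φ) ≡ total xs φ

open Invariant

Invariant-≋ : ∀ {xs D h h′} → h ≋ h′ mod D → Invariant xs D h → Invariant xs D h′
Invariant-≋ {xs} h≋h′ inv .invariance φ per =
  trans (total-cong xs λ x → per (+-congˡ-mod x (≋-sym h≋h′))) (invariance inv φ per)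

Invariant-multiple : ∀ {xs D h} → Invariant xs D h → ∀ j → Invariant xs D (+ j * h)
Invariant-multiple {xs} {h = h} inv zero .invariance φ per = total-cong xs λ x → cong φ (lemma x h)
  where
  lemma : ∀ x h → x + + 0 * h ≡ x
  lemma = solve-∀
Invariant-multiple {xs} {h = h} inv (suc j) .invariance φ per = begin
  total xs (shift (+ suc j * h) φ)         ≡⟨ total-cong xs (λ x → cong φ (lemma x (+ j) h)) ⟩
  total xs (shift h (shift (+ j * h) φ))   ≡⟨ invariance inv (shift (+ j * h) φ) (shift-periodic (+ j * h) per) ⟩
  total xs (shift (+ j * h) φ)             ≡⟨ invariance (Invariant-multiple inv j) φ per ⟩
  total xs φ                               ∎
  where
  lemma : ∀ x j h → x + (+ 1 + j) * h ≡ x + h + j * h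
  lemma = solve-∀

-- Averaging a D-periodic function over the shifts by multiples of d makes it d-periodic.
Invariant-average : ∀ {xs D d h} L .{{_ : NonZero L}} → + L * d ≋ + 0 mod D →
  Invariant xs D d → Invariant xs d h → Invariant xs D h
Invariant-average {xs} {D} {d} {h} L Ld≋0 inv-d inv-h .invariance φ per =
  ℤ.*-cancelˡ-≡ (+ L) _ _ (begin
    + L * total xs (shift h φ)                          ≡⟨ average (shift h φ) (shift-periodic h per) ⟨
    total xs (Avg (shift h φ))                          ≡⟨ total-cong xs (λ x → ∑-cong L λ j → cong φ (lemma x h (+ j * d))) ⟩
    total xs (shift h (Avg φ))                          ≡⟨ invariance inv-h (Avg φ) Avg-periodic ⟩
    total xs (Avg φ)                                    ≡⟨ average φ per ⟩
    + L * total xs φ                                    ∎)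
  where
  instance
    +L≢0 : ℤ.NonZero (+ L)
    +L≢0 = ℤ.≢-nonZero (ℕ.≢-nonZero⁻¹ L ∘ ℤ.+-injective)

  Avg : (ℤ → ℤ) → ℤ → ℤ
  Avg ψ x = ∑ L λ j → ψ (x + + j * d)

  lemma : ∀ x h z → x + z + h ≡ x + h + z
  lemma = solve-∀

  average : ∀ ψ → Periodic D ψ → total xs (Avg ψ) ≡ + L * total xs ψ
  average ψ ψ-per = begin
    total xs (Avg ψ)                               ≡⟨ total-∑ xs L (λ j → shift (+ j * d) ψ) ⟩
    ∑ L (λ j → total xs (shift (+ j * d) ψ))       ≡⟨ ∑-cong L (λ j → invariance (Invariant-multiple inv-d j) ψ ψ-per) ⟩
    ∑ L (λ _ → total xs ψ)                         ≡⟨ ∑-const L (total xs ψ) ⟩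
    + L * total xs ψ                               ∎

  -- Translation by a multiple of d permutes the L summands cyclically, because Ld vanishes modulo
  -- D.
  Avg-periodic : Periodic d (Avg φ)
  Avg-periodic {y = y} (mod-by q refl) = begin
    ∑ L (λ j → φ (y + q * d + + j * d))        ≡⟨ ∑-cong L (λ j → cong φ (lemma₂ y q d (+ j))) ⟩
    ∑ L (λ j → φ (y + (+ j + q) * d))          ≡⟨ ∑-shift-periodic L (λ z → φ (y + z * d)) G-periodic q ⟩
    ∑ L (λ j → φ (y + + j * d))                ∎
    where
    lemma₂ : ∀ y q d j → y + q * d + j * d ≡ y + (j + q) * d
    lemma₂ = solve-∀
    lemma₃ : ∀ z q L d → (z + q * L) * d ≡ z * d + q * (L * d)
    lemma₃ = solve-∀
    lemma₄ : ∀ y q → y + q * + 0 ≡ y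
    lemma₄ = solve-∀
    G-periodic : Periodic (+ L) (λ z → φ (y + z * d))
    G-periodic {y = z} (mod-by q refl) = per (+-congˡ-mod y
      (lemma₃ z q (+ L) d ≡then≋ +-congˡ-mod (z * d) (*-congˡ-mod q Ld≋0)
        ≋then≡ lemma₄ (z * d) q))

-- Twisted lines

twistedValue : ℤ → ℤ → ℤ → ℕ → ℤ
twistedValue ρ B δ k = ρ ^ k * (B + + k * δ)

twistedLine : ℤ → ℤ → ℤ → ℕ → List ℤ
twistedLine ρ B δ N = applyUpTo (twistedValue ρ B δ) N

module _ {D ρ ρ⁻¹ : ℤ} (ρρ⁻¹ : ρ * ρ⁻¹ ≋ + 1 mod D) {N : ℕ} .{{_ : NonZero N}}
         (ρᴺ : ρ ^ N ≋ + 1 mod D) (N≋0 : + N ≋ + 0 mod D) where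

  twistedValue-periodic : ∀ B δ k → twistedValue ρ B δ (N ℕ.+ k) ≋ twistedValue ρ B δ k mod D
  twistedValue-periodic B δ k =
    *-cong-mod (ℤ.^-distribˡ-+-* ρ N k ≡then≋ *-cong-mod ρᴺ (≋-refl {x = ρ ^ k}) ≋then≡ ℤ.*-identityˡ (ρ ^ k))
      (+-congˡ-mod B (*-cong-mod (+-cong-mod N≋0 (≋-refl {x = + k}) ≋then≡ ℤ.+-identityˡ (+ k)) (≋-refl {x = δ})))

  -- Averaging over k ↦ k + i p turns the twisted line into ordinary progressions of step ρᵏpδ.
  twistedLine-progressions : ∀ B δ p → ρ ^ p ≋ + 1 mod D → ∀ φ → Periodic D φ →
    + N * total (twistedLine ρ B δ N) φ ≡
    ∑ N λ k → ∑ N λ i → φ (twistedValue ρ B δ k + + i * (ρ ^ k * (+ p * δ)))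
  twistedLine-progressions B δ p ρᵖ φ per = begin
    + N * total (twistedLine ρ B δ N) φ                    ≡⟨ cong (+ N *_) (total-applyUpTo v N φ) ⟩
    + N * ∑ N (φ ∘ v)                                      ≡⟨ ∑-const N (∑ N (φ ∘ v)) ⟨
    ∑ N (λ i → ∑ N (φ ∘ v))                                ≡⟨ ∑-cong N (λ i → ∑-+ℕ-periodic N (φ ∘ v) (per ∘ twistedValue-periodic B δ) (i ℕ.* p)) ⟨
    ∑ N (λ i → ∑ N (λ k → φ (v (k ℕ.+ i ℕ.* p))))          ≡⟨ ∑-comm N N (λ i k → φ (v (k ℕ.+ i ℕ.* p))) ⟩
    ∑ N (λ k → ∑ N (λ i → φ (v (k ℕ.+ i ℕ.* p))))          ≡⟨ ∑-cong N (λ k → ∑-cong N λ i → per (v-+ k i)) ⟩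
    ∑ N (λ k → ∑ N (λ i → φ (v k + + i * (ρ ^ k * (+ p * δ))))) ∎
    where
    v = twistedValue ρ B δ
    lemma : ∀ r B k j δ → r * (B + (k + j) * δ) ≡ r * (B + k * δ) + r * (j * δ)
    lemma = solve-∀
    lemma₂ : ∀ r i p δ → r * (i * p * δ) ≡ i * (r * (p * δ))
    lemma₂ = solve-∀
    v-+ : ∀ k i → v (k ℕ.+ i ℕ.* p) ≋ v k + + i * (ρ ^ k * (+ p * δ)) mod D
    v-+ k i =
      *-cong-mod
        (ℤ.^-distribˡ-+-* ρ k (i ℕ.* p) ≡then≋ *-congˡ-mod (ρ ^ k)
          (trans (cong (ρ ^_) (ℕ.*-comm i p)) (sym (ℤ.^-*-assoc ρ p i)) ≡then≋ ^≋1 i ρᵖ)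
          ≋then≡ ℤ.*-identityʳ (ρ ^ k))
        (≋-refl {x = B + + (k ℕ.+ i ℕ.* p) * δ})
      ≋then≡ (begin
        ρ ^ k * (B + (+ k + + (i ℕ.* p)) * δ)                    ≡⟨ lemma (ρ ^ k) B (+ k) (+ (i ℕ.* p)) δ ⟩
        ρ ^ k * (B + + k * δ) + ρ ^ k * (+ (i ℕ.* p) * δ)        ≡⟨ cong (λ z → v k + ρ ^ k * (z * δ)) (ℤ.pos-* i p) ⟩
        ρ ^ k * (B + + k * δ) + ρ ^ k * (+ i * + p * δ)          ≡⟨ cong (λ z → v k + z) (lemma₂ (ρ ^ k) (+ i) (+ p) δ) ⟩
        v k + + i * (ρ ^ k * (+ p * δ))                          ∎)

  -- In the progression through the k-th value, of step ρᵏpδ, translation by pδh is a move by ρ⁻ᵏh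
  -- steps. The progression closes up after N steps because N vanishes modulo D, so each inner sum
  -- is unchanged.
  twistedLine-invariant : ∀ B δ p → ρ ^ p ≋ + 1 mod D → ∀ h →
    Invariant (twistedLine ρ B δ N) D (+ p * δ * h)
  twistedLine-invariant B δ p ρᵖ h .invariance φ per = ℤ.*-cancelˡ-≡ (+ N) _ _ (begin
    + N * total (twistedLine ρ B δ N) (shift s φ)          ≡⟨ twistedLine-progressions B δ p ρᵖ (shift s φ) (shift-periodic s per) ⟩
    ∑ N (λ k → ∑ N λ i → φ (v k + + i * c k + s))          ≡⟨ ∑-cong N (λ k → ∑-cong N λ i → per (absorb k i)) ⟩
    ∑ N (λ k → ∑ N λ i → φ (v k + (+ i + ρ⁻¹ ^ k * h) * c k)) ≡⟨ ∑-cong N (λ k → ∑-shift-periodic N (λ z → φ (v k + z * c k)) (progression-periodic k) (ρ⁻¹ ^ k * h)) ⟩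
    ∑ N (λ k → ∑ N λ i → φ (v k + + i * c k))              ≡⟨ twistedLine-progressions B δ p ρᵖ φ per ⟨
    + N * total (twistedLine ρ B δ N) φ                    ∎)
    where
    instance
      +N≢0 : ℤ.NonZero (+ N)
      +N≢0 = ℤ.≢-nonZero (ℕ.≢-nonZero⁻¹ N ∘ ℤ.+-injective)
    v = twistedValue ρ B δ
    s = + p * δ * h
    c : ℕ → ℤ
    c k = ρ ^ k * (+ p * δ)
    lemma₁ : ∀ s → s ≡ + 1 * s
    lemma₁ = solve-∀
    lemma₂ : ∀ r r' x h → r * r' * (x * h) ≡ (r' * h) * (r * x)
    lemma₂ = solve-∀
    lemma₃ : ∀ v i a c → v + i * c + a * c ≡ v + (i + a) * c
    lemma₃ = solve-∀
    absorb : ∀ k i → v k + + i * c k + s ≋ v k + (+ i + ρ⁻¹ ^ k * h) * c k mod D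
    absorb k i = +-congˡ-mod (v k + + i * c k)
      (lemma₁ s ≡then≋ *-cong-mod (≋-sym (^-inverse ρρ⁻¹ k)) (≋-refl {x = s})
        ≋then≡ lemma₂ (ρ ^ k) (ρ⁻¹ ^ k) (+ p * δ) h)
      ≋then≡ lemma₃ (v k) (+ i) (ρ⁻¹ ^ k * h) (c k)
    lemma₄ : ∀ z q c N → (z + q * N) * c ≡ z * c + q * c * N
    lemma₄ = solve-∀
    lemma₅ : ∀ y q → y + q * + 0 ≡ y
    lemma₅ = solve-∀
    progression-periodic : ∀ k → Periodic (+ N) (λ z → φ (v k + z * c k))
    progression-periodic k {y = z} (mod-by q refl) = per (+-congˡ-mod (v k)
      (lemma₄ z q (c k) (+ N) ≡then≋ +-congˡ-mod (z * c k) (*-congˡ-mod (q * c k) N≋0)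
        ≋then≡ lemma₅ (z * c k) (q * c k)))

-- Well-founded induction on `n`, which is replaced by a smaller gcd; `w` records that 2V and `n`
-- are coprime. The first factor of the modulus has the form U = 2V because gδ is 2 and not 1: a
-- multiple of δ that is congruent to U is then obtained by multiplying gδ by V.
twistedLine-invariant-2-coprime : ∀ {V w ρ ρ⁻¹ B δ g N} .{{_ : NonZero N}} n .{{_ : NonZero n}} → Acc _<_ n →
  let D = + 2 * V * + n in
  w * (+ 2 * V) ≋ + 1 mod + n → ρ ≋ + 1 mod (+ 2 * V) →
  ρ * ρ⁻¹ ≋ + 1 mod D → g * δ ≋ + 2 mod D → ρ ^ N ≋ + 1 mod D → + N ≋ + 0 mod D →
  Invariant (twistedLine ρ B δ N) D (+ 2)
twistedLine-invariant-2-coprime {V} {w} {ρ} {ρ⁻¹} {B} {δ} {g} {N} n (acc rec) wU ρ≋1 ρρ⁻¹ gδ ρᴺ N≋0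
  with n ℕ.≟ 1
-- For n = 1 the modulus is U itself, where ρ ≡ 1: the period 1 gives translation by δg ≡ 2.
... | yes refl = Invariant-≋ (lemma g δ ≡then≋ gδ)
  (twistedLine-invariant ρρ⁻¹ ρᴺ N≋0 B δ 1 (ℤ.^-identityʳ ρ ≡then≋ subst (ρ ≋ + 1 mod_) (sym (ℤ.*-identityʳ (+ 2 * V))) ρ≋1) g)
  where
  lemma : ∀ g δ → + 1 * δ * g ≡ g * δ
  lemma = solve-∀
... | no n≢1
  with p , 0<p , p<n , ρᵖ ← small-period n (ℕ.≤∧≢⇒< (ℕ.>-nonZero⁻¹ n) (n≢1 ∘ sym)) (≋-divisor {q = + 2 * V} ρρ⁻¹)
  with y , gcd≋ ← bezout p n
     | divides L n≡L*n′ ← ℕ.gcd[m,n]∣n p n =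
  -- Invariance under d = U gcd(p, n) lowers the modulus from D to d. There the induction hypothesis
  -- applies, since gcd(p, n) ≤ p < n.
  Invariant-average L (Ld ≡then≋ multiple≋0 (+ 1)) inv-d inv-2
  where
  U = + 2 * V
  D = U * + n
  n′ = ℕ.gcd p n
  instance
    p≢0 : NonZero p
    p≢0 = ℕ.>-nonZero 0<p
    L≢0 : NonZero L
    L≢0 = ℕ.≢-nonZero λ { refl → ℕ.≢-nonZero⁻¹ n n≡L*n′ }
    n′≢0 : NonZero n′
    n′≢0 = ℕ.≢-nonZero λ n′≡0 → ℕ.≢-nonZero⁻¹ p (ℕ.gcd[m,n]≡0⇒m≡0 n′≡0)
  d = U * + n′
  n≡ : + n ≡ + L * + n′
  n≡ = trans (cong +_ n≡L*n′) (ℤ.pos-* L n′)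
  lemma₁ : ∀ L U n′ → L * (U * n′) ≡ + 1 * (U * (L * n′))
  lemma₁ = solve-∀
  Ld : + L * d ≡ + 1 * D
  Ld = trans (lemma₁ (+ L) U (+ n′)) (cong (λ z → + 1 * (U * z)) (sym n≡))
  D≡ : D ≡ + L * d
  D≡ = trans (sym (ℤ.*-identityˡ D)) (sym Ld)
  to-d : ∀ {x y} → x ≋ y mod D → x ≋ y mod d
  to-d {x} {y} = ≋-divisor {q = + L} ∘ subst (x ≋ y mod_) D≡
  ρᵖ-D : ρ ^ p ≋ + 1 mod D
  ρᵖ-D = crt-1 {x = w} wU (^≋1 p ρ≋1) ρᵖ
  lemma₂ : ∀ p δ g V y → p * δ * (g * (V * y)) ≡ p * (V * y) * (g * δ)
  lemma₂ = solve-∀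
  lemma₃ : ∀ p V y → p * (V * y) * + 2 ≡ + 2 * V * (y * p)
  lemma₃ = solve-∀
  scale : ∀ {x y} → x ≋ y mod + n → U * x ≋ U * y mod D
  scale {y = y} (mod-by q refl) = mod-by q (lemma U y q (+ n))
    where
    lemma : ∀ U y q n → U * (y + q * n) ≡ U * y + q * (U * n)
    lemma = solve-∀
  -- With y a Bézout coefficient, pδ · gVy ≡ 2Vpy = U(yp) ≡ U gcd(p, n) modulo Un.
  inv-d : Invariant (twistedLine ρ B δ N) D d
  inv-d = Invariant-≋
    (lemma₂ (+ p) δ g V y ≡then≋
      ≋-trans (*-congˡ-mod (+ p * (V * y)) gδ)
        (lemma₃ (+ p) V y ≡then≋ ≋-sym (scale gcd≋)))
    (twistedLine-invariant ρρ⁻¹ ρᴺ N≋0 B δ p ρᵖ-D (g * (V * y)))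
  inv-2 : Invariant (twistedLine ρ B δ N) d (+ 2)
  inv-2 = twistedLine-invariant-2-coprime {V = V} {w} {ρ} {ρ⁻¹} {B} {δ} {g} {N} n′
    (rec (ℕ.≤-<-trans (ℕ.∣⇒≤ (ℕ.gcd[m,n]∣m p n)) p<n))
    (≋-divisor {q = + L} (subst (w * U ≋ + 1 mod_) n≡ wU)) ρ≋1
    (to-d ρρ⁻¹) (to-d gδ) (to-d ρᴺ) (to-d N≋0)

-- Antidifferences

-- This condition holds both for units and for elements whose gcd with the modulus is 2, so all the
-- directions in the tetrahedron are treated alike.
DividesTwo : ℤ → ℤ → Set
DividesTwo D e = ∃ λ g → g * e ≋ + 2 mod D

DividesTwo-neg : ∀ {D x y} → DividesTwo D (x - y) → DividesTwo D (y - x)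
DividesTwo-neg {x = x} {y} (g , eq) = - g , (lemma g x y ≡then≋ eq)
  where
  lemma : ∀ g x y → - g * (y - x) ≡ g * (x - y)
  lemma = solve-∀

DividesTwo-*-unit : ∀ {D e c c⁻¹} → c * c⁻¹ ≋ + 1 mod D → DividesTwo D e → DividesTwo D (c * e)
DividesTwo-*-unit {D} {e} {c} {c⁻¹} inv (g , eq) = g * c⁻¹ ,
  (lemma g c c⁻¹ e ≡then≋ ≋-trans (*-congʳ-mod (g * e) inv) (ℤ.*-identityˡ (g * e) ≡then≋ eq))
  where
  lemma : ∀ g c c' e → g * c' * (c * e) ≡ c * c' * (g * e)
  lemma = solve-∀

-- Translation by 2 ≡ ge is a move by g steps along a progression that closes up after m steps.
progression-sum-+2 : ∀ {e} m {φ} → Periodic (+ m) φ → DividesTwo (+ m) e → ∀ x →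
  ∑ m (λ i → φ (x + + i * e + + 2)) ≡ ∑ m (λ i → φ (x + + i * e))
progression-sum-+2 {e} m {φ} per (g , ge) x = begin
  ∑ m (λ i → φ (x + + i * e + + 2))      ≡⟨ ∑-cong m (λ i → per (≋-sym (lemma x (+ i) e g ≡then≋ +-congˡ-mod (x + + i * e) ge))) ⟩
  ∑ m (λ i → φ (x + (+ i + g) * e))      ≡⟨ ∑-shift-periodic m (λ z → φ (x + z * e)) G-periodic g ⟩
  ∑ m (λ i → φ (x + + i * e))            ∎
  where
  lemma : ∀ x i e g → x + (i + g) * e ≡ x + i * e + g * e
  lemma = solve-∀
  lemma₂ : ∀ x z q e m → x + (z + q * m) * e ≡ x + z * e + q * e * m
  lemma₂ = solve-∀
  G-periodic : Periodic (+ m) (λ z → φ (x + z * e))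
  G-periodic {y = z} (mod-by q refl) = per (mod-by (q * e) (lemma₂ x z q e (+ m)))

x-x≡0 : ∀ {x y} → x ≡ y → x - y ≡ + 0
x-x≡0 {x} refl = ℤ.+-inverseʳ x

-- Summation by parts against the weight j.
∑-weighted-difference : ∀ n f →
  ∑ n (λ j → + j * f (suc j)) - ∑ n (λ j → + j * f j) ≡ + n * f n - ∑ n (f ∘ suc)
∑-weighted-difference n f = begin
  a - ∑ n w                      ≡⟨ lemma a (∑ n w) s ⟩
  a + s - ∑ n w - s              ≡⟨ cong (λ z → z - ∑ n w - s) (∑-+ n (λ j → + j * f (suc j)) (f ∘ suc)) ⟨
  ∑ n (λ j → + j * f (suc j) + f (suc j)) - ∑ n w - s
                                 ≡⟨ cong (λ z → z - ∑ n w - s) (∑-cong n λ j → lemma₂ (+ j) (f (suc j))) ⟩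
  ∑ n (w ∘ suc) - ∑ n w - s      ≡⟨ cong (λ z → z - ∑ n w - s) (ℤ.+-identityˡ (∑ n (w ∘ suc))) ⟨
  + 0 * f 0 + ∑ n (w ∘ suc) - ∑ n w - s      ≡⟨ cong (λ z → z - ∑ n w - s) (∑-last n w) ⟩
  ∑ n w + w n - ∑ n w - s        ≡⟨ lemma₃ (∑ n w) (w n) s ⟩
  w n - s                        ∎
  where
  w : ℕ → ℤ
  w j = + j * f j
  a = ∑ n (λ j → + j * f (suc j))
  s = ∑ n (f ∘ suc)
  lemma : ∀ a b s → a - b ≡ a + s - b - s
  lemma = solve-∀
  lemma₂ : ∀ j x → j * x + x ≡ (+ 1 + j) * x
  lemma₂ = solve-∀
  lemma₃ : ∀ b w s → b + w - b - s ≡ w - s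
  lemma₃ = solve-∀

-- These are the properties of the difference ψ that survive antidifferencing. The twist by ρᵏ is
-- absorbed into the k-th function, so the points of every layer k become affine in the coordinates:
-- rows lie in one layer, columns cross all layers of a period N.
record NullFamily (m N : ℕ) (θ : ℕ → ℤ → ℤ) : Set where
  field
    periodic    : ∀ k → Periodic (+ m) (θ k)
    row-null    : ∀ k x e → DividesTwo (+ m) e → ∑ m (λ i → θ k (x + + i * e)) ≡ + 0
    column-null : ∀ B δ → DividesTwo (+ m) δ → ∑ N (λ k → θ k (B + + k * δ)) ≡ + 0

open NullFamily

-- In layer k a row becomes a progression whose step is a unit times `e`, hence still divides 2. A
-- column becomes a difference of totals over a twisted line.
difference-null : ∀ {m N ρ ρ⁻¹} → ρ * ρ⁻¹ ≋ + 1 mod + m →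
  (∀ B δ → DividesTwo (+ m) δ → Invariant (twistedLine ρ B δ N) (+ m) (+ 2)) →
  ∀ {φ} → Periodic (+ m) φ → NullFamily m N (λ k x → φ (ρ ^ k * x + + 2) - φ (ρ ^ k * x))
difference-null {m} {N} {ρ} {ρ⁻¹} inv lines {φ} per = record
  { periodic    = λ k x≋y → cong₂ _-_ (per (+-congʳ-mod (+ 2) (*-congˡ-mod (ρ ^ k) x≋y))) (per (*-congˡ-mod (ρ ^ k) x≋y))
  ; row-null    = λ k x e e∣2 → let c = ρ ^ k in begin
      ∑ m (λ i → φ (c * (x + + i * e) + + 2) - φ (c * (x + + i * e)))
        ≡⟨ ∑-cong m (λ i → cong (λ z → φ (z + + 2) - φ z) (lemma c x (+ i) e)) ⟩
      ∑ m (λ i → φ (c * x + + i * (c * e) + + 2) - φ (c * x + + i * (c * e)))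
        ≡⟨ ∑-- m (λ i → φ (c * x + + i * (c * e) + + 2)) (λ i → φ (c * x + + i * (c * e))) ⟩
      _ ≡⟨ x-x≡0 (progression-sum-+2 m per (DividesTwo-*-unit {c = c} {ρ⁻¹ ^ k} (^-inverse inv k) e∣2) (c * x)) ⟩
      + 0 ∎
  ; column-null = λ B δ δ∣2 → begin
      ∑ N (λ k → shift (+ 2) φ (twistedValue ρ B δ k) - φ (twistedValue ρ B δ k))
        ≡⟨ ∑-- N (shift (+ 2) φ ∘ twistedValue ρ B δ) (φ ∘ twistedValue ρ B δ) ⟩
      _ ≡⟨ x-x≡0 (trans (sym (total-applyUpTo (twistedValue ρ B δ) N (shift (+ 2) φ)))
                  (trans (invariance (lines B δ δ∣2) φ per) (total-applyUpTo (twistedValue ρ B δ) N φ))) ⟩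
      + 0 ∎
  }
  where
  lemma : ∀ c x i e → c * (x + i * e) ≡ c * x + i * (c * e)
  lemma = solve-∀

antidifference : ℕ → ℤ → (ℕ → ℤ → ℤ) → ℕ → ℤ → ℤ
antidifference m e θ k x = ∑ m λ j → + j * θ k (x + + j * e)

module _ {m N : ℕ} {θ : ℕ → ℤ → ℤ} (null : NullFamily m N θ) where

  -- The vanishing conditions hold at every base point, so they hold for the translate by je in each
  -- summand. Antidifferences can therefore be taken repeatedly.
  antidifference-null : ∀ e → NullFamily m N (antidifference m e θ)
  antidifference-null e = record
    { periodic    = λ k x≋y → ∑-cong m λ j → cong (+ j *_) (periodic null k (+-congʳ-mod (+ j * e) x≋y))
    ; row-null    = λ k x e′ e′∣2 → swap m (λ i → θ k) (λ i → x + + i * e′)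
        λ j → trans (∑-cong m λ i → cong (θ k) (lemma x (+ i * e′) (+ j * e))) (row-null null k (x + + j * e) e′ e′∣2)
    ; column-null = λ B δ δ∣2 → swap N θ (λ k → B + + k * δ)
        λ j → trans (∑-cong N λ k → cong (θ k) (lemma B (+ k * δ) (+ j * e))) (column-null null (B + + j * e) δ δ∣2)
    }
    where
    lemma : ∀ x y z → x + y + z ≡ x + z + y
    lemma = solve-∀
    swap : ∀ n (η : ℕ → ℤ → ℤ) (v : ℕ → ℤ) → (∀ j → ∑ n (λ k → η k (v k + + j * e)) ≡ + 0) →
      ∑ n (λ k → ∑ m λ j → + j * η k (v k + + j * e)) ≡ + 0
    swap n η v inner≡0 = trans (∑-comm n m λ k j → + j * η k (v k + + j * e)) (∑-zero m λ j → begin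
      ∑ n (λ k → + j * η k (v k + + j * e))    ≡⟨ ∑-*ˡ n (+ j) (λ k → η k (v k + + j * e)) ⟩
      + j * ∑ n (λ k → η k (v k + + j * e))    ≡⟨ cong (+ j *_) (inner≡0 j) ⟩
      + j * + 0                                ≡⟨ ℤ.*-zeroʳ (+ j) ⟩
      + 0                                      ∎)

  -- Summation by parts leaves m times the value at x + me, which is the value at x by periodicity,
  -- minus the sum over a full row, which vanishes.
  antidifference-difference : ∀ {e} → DividesTwo (+ m) e → ∀ k x →
    antidifference m e θ k (x + e) - antidifference m e θ k x ≡ + m * θ k x
  antidifference-difference {e} e∣2 k x = begin
    antidifference m e θ k (x + e) - antidifference m e θ k x
      ≡⟨ cong (_- antidifference m e θ k x) (∑-cong m λ j → cong (λ z → + j * θ k z) (lemma₁ x (+ j) e)) ⟩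
    ∑ m (λ j → + j * f (suc j)) - ∑ m (λ j → + j * f j)      ≡⟨ ∑-weighted-difference m f ⟩
    + m * f m - ∑ m (f ∘ suc)                                ≡⟨ cong₂ (λ y z → + m * y - z) (periodic null k (mod-by e (lemma₂ x (+ m) e))) row ⟩
    + m * θ k x - + 0                                        ≡⟨ ℤ.+-identityʳ (+ m * θ k x) ⟩
    + m * θ k x                                              ∎
    where
    f : ℕ → ℤ
    f j = θ k (x + + j * e)
    lemma₁ : ∀ x j e → x + e + j * e ≡ x + (+ 1 + j) * e
    lemma₁ = solve-∀
    lemma₂ : ∀ x m e → x + m * e ≡ x + e * m
    lemma₂ = solve-∀
    row : ∑ m (f ∘ suc) ≡ + 0
    row = trans (∑-cong m λ j → cong (θ k) (sym (lemma₁ x (+ j) e))) (row-null null k (x + e) e e∣2)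

-- Triangles and tetrahedra

-- (X − 1)(Y − 1)(X − Y) applied to g, where X and Y shift the two indices.
vandermonde : (ℕ → ℕ → ℤ) → ℕ → ℕ → ℤ
vandermonde g i j =
  g (2 ℕ.+ i) (1 ℕ.+ j) - g (1 ℕ.+ i) (2 ℕ.+ j) - g (2 ℕ.+ i) j + g i (2 ℕ.+ j) + g (1 ℕ.+ i) j - g i (1 ℕ.+ j)

∑-telescope : ∀ n (f : ℕ → ℤ) → ∑ n (λ j → f (suc j) - f j) ≡ f n - f 0
∑-telescope zero    f = sym (ℤ.+-inverseʳ (f 0))
∑-telescope (suc n) f =
  trans (cong (λ z → f 1 - f 0 + z) (∑-telescope n (f ∘ suc))) (lemma (f 0) (f 1) (f (suc n)))
  where
  lemma : ∀ a b c → b - a + (c - b) ≡ c - a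
  lemma = solve-∀

triangle : ℕ → (ℕ → ℕ → ℤ) → ℤ
triangle n f = ∑ n λ i → ∑ (n ℕ.∸ i) (f i)

-- Induction on the size, taking off the row i = 0: within a row the summand is a difference in j,
-- because of the factor Y - 1, and telescopes.
triangle-vandermonde : ∀ n g → triangle n (vandermonde g) ≡
  g (suc n) 1 - g (suc n) 0 - g 1 (suc n) + g 0 (suc n) + g 1 0 - g 0 1
triangle-vandermonde zero g = lemma (g 1 1) (g 1 0) (g 0 1)
  where
  lemma : ∀ a b c → + 0 ≡ a - b - a + c + b - c
  lemma = solve-∀
triangle-vandermonde (suc n) g = begin
  ∑ (suc n) (vandermonde g 0) + triangle n (vandermonde (g ∘ suc))
    ≡⟨ cong₂ _+_ row (triangle-vandermonde n (g ∘ suc)) ⟩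
  _ ≡⟨ lemma (g 2 (suc n)) (g 1 (2 ℕ.+ n)) (g 1 (suc n)) (g 0 (2 ℕ.+ n)) (g 2 0) (g 1 1) (g 1 0) (g 0 1)
         (g (2 ℕ.+ n) 1) (g (2 ℕ.+ n) 0) ⟩
  _ ∎
  where
  -- This is (X - 1)(X - Y) applied to g, along the row i = 0.
  q : ℕ → ℤ
  q j = g 2 j - g 1 (suc j) - g 1 j + g 0 (suc j)
  lemma₁ : ∀ a b c d e f h → a - b - c + d + e - f ≡ (a - b - h + d) - (c - h - e + f)
  lemma₁ = solve-∀
  row : ∑ (suc n) (vandermonde g 0) ≡ q (suc n) - q 0
  row = trans (∑-cong (suc n) λ j → lemma₁ (g 2 (suc j)) (g 1 (2 ℕ.+ j)) (g 2 j) (g 0 (2 ℕ.+ j)) (g 1 j) (g 0 (suc j)) (g 1 (suc j))) (∑-telescope (suc n) q)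
  lemma : ∀ a b c d e f h i u v →
    (a - b - c + d) - (e - f - h + i) + (u - v - a + c + e - f) ≡ u - v - b + d + h - i
  lemma = solve-∀

triangle-cong : ∀ n {f g} → (∀ i j → f i j ≡ g i j) → triangle n f ≡ triangle n g
triangle-cong n f≡g = ∑-cong n λ i → ∑-cong (n ℕ.∸ i) (f≡g i)

triangle-*ˡ : ∀ n c f → triangle n (λ i j → c * f i j) ≡ c * triangle n f
triangle-*ˡ n c f =
  trans (∑-cong n λ i → ∑-*ˡ (n ℕ.∸ i) c (f i)) (∑-*ˡ n c (λ i → ∑ (n ℕ.∸ i) (f i)))

triangle-- : ∀ n f g → triangle n (λ i j → f i j - g i j) ≡ triangle n f - triangle n g
triangle-- n f g =
  trans (∑-cong n λ i → ∑-- (n ℕ.∸ i) (f i) (g i)) (∑-- n (λ i → ∑ (n ℕ.∸ i) (f i)) (λ i → ∑ (n ℕ.∸ i) (g i)))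

-- Removing the column j = 0 leaves a triangle of size n, since the last row becomes empty. This
-- mirrors the unfolding of `triangle` along its first row and so yields the symmetry below.
triangle-first-column : ∀ n f →
  triangle (suc n) f ≡ ∑ (suc n) (λ i → f i 0) + triangle n (λ i j → f i (suc j))
triangle-first-column n f = begin
  triangle (suc n) f                                     ≡⟨ ∑-cong< (suc n) (λ i i≤n → cong (λ k → ∑ k (f i)) (ℕ.+-∸-assoc 1 (ℕ.s≤s⁻¹ i≤n))) ⟩
  ∑ (suc n) (λ i → f i 0 + column i)                     ≡⟨ ∑-+ (suc n) (λ i → f i 0) column ⟩
  ∑ (suc n) (λ i → f i 0) + ∑ (suc n) column             ≡⟨ cong (λ z → ∑ (suc n) (λ i → f i 0) + z) (∑-last n column) ⟩
  ∑ (suc n) (λ i → f i 0) + (∑ n column + column n)      ≡⟨ cong (λ k → ∑ (suc n) (λ i → f i 0) + (∑ n column + ∑ k (f n ∘ suc))) (ℕ.n∸n≡0 n) ⟩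
  ∑ (suc n) (λ i → f i 0) + (∑ n column + + 0)           ≡⟨ cong (λ z → ∑ (suc n) (λ i → f i 0) + z) (ℤ.+-identityʳ (∑ n column)) ⟩
  ∑ (suc n) (λ i → f i 0) + ∑ n column                   ∎
  where
  column : ℕ → ℤ
  column i = ∑ (n ℕ.∸ i) (f i ∘ suc)

triangle-transpose : ∀ n f → triangle n f ≡ triangle n (λ i j → f j i)
triangle-transpose zero    f = refl
triangle-transpose (suc n) f =
  trans (cong (λ z → ∑ (suc n) (f 0) + z) (triangle-transpose n (f ∘ suc)))
        (sym (triangle-first-column n (λ i j → f j i)))

tetrahedron-sum : ℕ → (ℕ → ℕ → ℕ → ℤ) → ℤ
tetrahedron-sum s f = ∑ s λ i → triangle (s ℕ.∸ i) (f i)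

-- The cyclic permutation is composed of two transpositions of triangles. It makes the third
-- coordinate, time, the outermost one, so that the inner triangles are horizontal layers.
tetrahedron-rotate : ∀ s f → tetrahedron-sum s f ≡ tetrahedron-sum s (λ k i j → f i j k)
tetrahedron-rotate s f = begin
  tetrahedron-sum s f
    ≡⟨ ∑-cong s (λ i → triangle-transpose (s ℕ.∸ i) (f i)) ⟩
  triangle s (λ i k → ∑ (s ℕ.∸ i ℕ.∸ k) λ j → f i j k)
    ≡⟨ triangle-transpose s (λ i k → ∑ (s ℕ.∸ i ℕ.∸ k) λ j → f i j k) ⟩
  triangle s (λ k i → ∑ (s ℕ.∸ i ℕ.∸ k) λ j → f i j k)
    ≡⟨ triangle-cong s (λ k i → cong (λ n → ∑ n λ j → f i j k) (∸-comm i k)) ⟩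
  tetrahedron-sum s (λ k i j → f i j k) ∎
  where
  ∸-comm : ∀ i k → s ℕ.∸ i ℕ.∸ k ≡ s ℕ.∸ k ℕ.∸ i
  ∸-comm i k = trans (ℕ.∸-+-assoc s i k) (trans (cong (s ℕ.∸_) (ℕ.+-comm i k)) (sym (ℕ.∸-+-assoc s k i)))

-- Collapse of a tetrahedron onto six lines.

-- The value of (X − 1)(Y − 1)(X − Y)∑ XᵃYᵇ, evaluated by f at the six monomials that survive.
boundary : (ℤ → ℤ) → (x₁ x₂ x₃ x₄ x₅ x₆ : ℤ) → ℤ
boundary f x₁ x₂ x₃ x₄ x₅ x₆ = f x₁ - f x₂ - f x₃ + f x₄ + f x₅ - f x₆

module _ {m N : ℕ} .{{_ : NonZero m}} {θ : ℕ → ℤ → ℤ} (null : NullFamily m N θ) {e₁ e₂ e₃ : ℤ}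
         (e₁∣2 : DividesTwo (+ m) e₁) (e₂∣2 : DividesTwo (+ m) e₂) (e₃∣2 : DividesTwo (+ m) e₃)
         (e₁-e₂∣2 : DividesTwo (+ m) (e₁ - e₂)) (e₃-e₁∣2 : DividesTwo (+ m) (e₃ - e₁))
         (e₃-e₂∣2 : DividesTwo (+ m) (e₃ - e₂)) where

  private
    η₁ η₂ η₃ : ℕ → ℤ → ℤ
    η₁ = antidifference m (e₁ - e₂) θ
    η₂ = antidifference m e₂ η₁
    η₃ = antidifference m e₁ η₂

    null₁ = antidifference-null null (e₁ - e₂)
    null₂ = antidifference-null null₁ e₂
    null₃ = antidifference-null null₂ e₁

  -- Each of the three differences undoes one antidifference and leaves a factor m. The displacement
  -- by e₂ arises because X - Y is the difference of step e₁ - e₂ taken at the point moved by Y.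
  vandermonde-antidifference : ∀ k z →
    η₃ k (z + + 2 * e₁ + + 1 * e₂) - η₃ k (z + + 1 * e₁ + + 2 * e₂) - η₃ k (z + + 2 * e₁ + + 0 * e₂)
      + η₃ k (z + + 0 * e₁ + + 2 * e₂) + η₃ k (z + + 1 * e₁ + + 0 * e₂) - η₃ k (z + + 0 * e₁ + + 1 * e₂)
      ≡ + m * (+ m * (+ m * θ k (z + e₂)))
  vandermonde-antidifference k z = begin
    u 2 1 - u 1 2 - u 2 0 + u 0 2 + u 1 0 - u 0 1
      ≡⟨ lemma₁ (u 2 1) (u 1 2) (u 2 0) (u 0 2) (u 1 0) (u 0 1) (u 1 1) ⟩
    (u 2 1 - u 1 1) - (u 1 2 - u 0 2) - (u 2 0 - u 1 0) + (u 1 1 - u 0 1)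
      ≡⟨ cong₂ _+_ (cong₂ _-_ (cong₂ _-_ (d₃ 1 1) (d₃ 0 2)) (d₃ 1 0)) (d₃ 0 1) ⟩
    + m * v 1 1 - + m * v 0 2 - + m * v 1 0 + + m * v 0 1
      ≡⟨ lemma₂ (+ m) (v 1 1) (v 0 2) (v 1 0) (v 0 1) ⟩
    + m * ((v 1 1 - v 1 0) - (v 0 2 - v 0 1))
      ≡⟨ cong (+ m *_) (cong₂ _-_ (d₂ 1 0) (d₂ 0 1)) ⟩
    + m * (+ m * w 1 0 - + m * w 0 1)
      ≡⟨ lemma₃ (+ m) (w 1 0) (w 0 1) ⟩
    + m * (+ m * (w 1 0 - w 0 1))
      ≡⟨ cong (λ y → + m * (+ m * y)) d₁ ⟩
    + m * (+ m * (+ m * θ k (z + e₂))) ∎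
    where
    at : (ℤ → ℤ) → ℕ → ℕ → ℤ
    at f i j = f (z + + i * e₁ + + j * e₂)
    u v w : ℕ → ℕ → ℤ
    u = at (η₃ k)
    v = at (η₂ k)
    w = at (η₁ k)
    lemma₁ : ∀ a b c d e f g → a - b - c + d + e - f ≡ (a - g) - (b - d) - (c - e) + (g - f)
    lemma₁ = solve-∀
    lemma₂ : ∀ m a b c d → m * a - m * b - m * c + m * d ≡ m * ((a - c) - (b - d))
    lemma₂ = solve-∀
    lemma₃ : ∀ m a b → m * (m * a - m * b) ≡ m * (m * (a - b))
    lemma₃ = solve-∀
    lemma₄ : ∀ z i j x y → z + (+ 1 + i) * x + j * y ≡ z + i * x + j * y + x
    lemma₄ = solve-∀
    lemma₅ : ∀ z i j x y → z + i * x + (+ 1 + j) * y ≡ z + i * x + j * y + y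
    lemma₅ = solve-∀
    lemma₆ : ∀ z x y → z + + 1 * x + + 0 * y ≡ z + y + (x - y)
    lemma₆ = solve-∀
    lemma₇ : ∀ z x y → z + + 0 * x + + 1 * y ≡ z + y
    lemma₇ = solve-∀
    d₃ : ∀ i j → u (suc i) j - u i j ≡ + m * v i j
    d₃ i j = trans (cong (λ y → η₃ k y - u i j) (lemma₄ z (+ i) (+ j) e₁ e₂))
                   (antidifference-difference null₂ e₁∣2 k (z + + i * e₁ + + j * e₂))
    d₂ : ∀ i j → v i (suc j) - v i j ≡ + m * w i j
    d₂ i j = trans (cong (λ y → η₂ k y - v i j) (lemma₅ z (+ i) (+ j) e₁ e₂))
                   (antidifference-difference null₁ e₂∣2 k (z + + i * e₁ + + j * e₂))
    d₁ : w 1 0 - w 0 1 ≡ + m * θ k (z + e₂)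
    d₁ = trans (cong₂ (λ x y → η₁ k x - η₁ k y) (lemma₆ z e₁ e₂) (lemma₇ z e₁ e₂))
               (antidifference-difference null e₁-e₂∣2 k (z + e₂))

  module _ (A : ℤ) (s : ℕ) where

    private
      A′ S : ℤ
      -- Moving the base point back by e₂ compensates for the displacement in
      -- `vandermonde-antidifference`.
      A′ = A - e₂
      -- Layer k has size s - k, so its far corners are at (s - k + 1)eᵢ + k e₃ = S eᵢ + k(e₃ - eᵢ),
      -- for i = 1, 2. As k varies they run along lines of step e₃ - eᵢ.
      S = + 1 + + s

      p₁ p₂ p₃ p₄ p₅ p₆ edges : ℕ → ℤ
      p₁ k = A′ + e₂ + S * e₁ + + k * (e₃ - e₁)
      p₂ k = A′ + S * e₁ + + k * (e₃ - e₁)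
      p₃ k = A′ + e₁ + S * e₂ + + k * (e₃ - e₂)
      p₄ k = A′ + S * e₂ + + k * (e₃ - e₂)
      p₅ k = A′ + e₁ + + k * e₃
      p₆ k = A′ + e₂ + + k * e₃
      edges k = boundary (η₃ k) (p₁ k) (p₂ k) (p₃ k) (p₄ k) (p₅ k) (p₆ k)

      ∑-boundary : ∀ n (f : ℕ → ℤ → ℤ) (x₁ x₂ x₃ x₄ x₅ x₆ : ℕ → ℤ) →
        ∑ n (λ k → f k (x₁ k)) ≡ + 0 → ∑ n (λ k → f k (x₂ k)) ≡ + 0 → ∑ n (λ k → f k (x₃ k)) ≡ + 0 →
        ∑ n (λ k → f k (x₄ k)) ≡ + 0 → ∑ n (λ k → f k (x₅ k)) ≡ + 0 → ∑ n (λ k → f k (x₆ k)) ≡ + 0 →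
        ∑ n (λ k → boundary (f k) (x₁ k) (x₂ k) (x₃ k) (x₄ k) (x₅ k) (x₆ k)) ≡ + 0
      ∑-boundary n f x₁ x₂ x₃ x₄ x₅ x₆ h₁ h₂ h₃ h₄ h₅ h₆ =
        minus (λ k → g x₁ k - g x₂ k - g x₃ k + g x₄ k + g x₅ k) (g x₆)
          (plus (λ k → g x₁ k - g x₂ k - g x₃ k + g x₄ k) (g x₅)
            (plus (λ k → g x₁ k - g x₂ k - g x₃ k) (g x₄)
              (minus (λ k → g x₁ k - g x₂ k) (g x₃) (minus (g x₁) (g x₂) h₁ h₂) h₃) h₄) h₅) h₆
        where
        g : (ℕ → ℤ) → ℕ → ℤ
        g x k = f k (x k)
        plus : ∀ a b → ∑ n a ≡ + 0 → ∑ n b ≡ + 0 → ∑ n (λ k → a k + b k) ≡ + 0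
        plus a b p q = trans (∑-+ n a b) (cong₂ _+_ p q)
        minus : ∀ a b → ∑ n a ≡ + 0 → ∑ n b ≡ + 0 → ∑ n (λ k → a k - b k) ≡ + 0
        minus a b p q = trans (∑-- n a b) (cong₂ _-_ p q)

      ∑-edges : ∑ N edges ≡ + 0
      ∑-edges = ∑-boundary N η₃ p₁ p₂ p₃ p₄ p₅ p₆
        (column-null null₃ (A′ + e₂ + S * e₁) (e₃ - e₁) e₃-e₁∣2) (column-null null₃ (A′ + S * e₁) (e₃ - e₁) e₃-e₁∣2)
        (column-null null₃ (A′ + e₁ + S * e₂) (e₃ - e₂) e₃-e₂∣2) (column-null null₃ (A′ + S * e₂) (e₃ - e₂) e₃-e₂∣2)
        (column-null null₃ (A′ + e₁) e₃ e₃∣2) (column-null null₃ (A′ + e₂) e₃ e₃∣2)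

      boundary-cong : ∀ f {x₁ x₂ x₃ x₄ x₅ x₆ y₁ y₂ y₃ y₄ y₅ y₆} →
        x₁ ≡ y₁ → x₂ ≡ y₂ → x₃ ≡ y₃ → x₄ ≡ y₄ → x₅ ≡ y₅ → x₆ ≡ y₆ →
        boundary f x₁ x₂ x₃ x₄ x₅ x₆ ≡ boundary f y₁ y₂ y₃ y₄ y₅ y₆
      boundary-cong f refl refl refl refl refl refl = refl

      -- The layer k = s is an empty triangle: its six boundary points coincide in pairs of opposite
      -- sign.
      edges-s : edges s ≡ + 0
      edges-s = trans
        (boundary-cong (η₃ s) (l₁ A′ e₂ e₁ e₃ (+ s)) (l₂ A′ e₁ e₃ (+ s)) (l₁′ A′ e₁ e₂ e₃ (+ s)) (l₂ A′ e₂ e₃ (+ s)) (refl {x = p₅ s}) (refl {x = p₆ s}))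
        (cancel (f (A′ + e₂ + e₁ + + s * e₃)) (f (A′ + e₁ + + s * e₃)) (f (A′ + e₂ + + s * e₃)))
        where
        f = η₃ s
        l₁ : ∀ a x y z s → a + x + (+ 1 + s) * y + s * (z - y) ≡ a + x + y + s * z
        l₁ = solve-∀
        l₁′ : ∀ a x y z s → a + x + (+ 1 + s) * y + s * (z - y) ≡ a + y + x + s * z
        l₁′ = solve-∀
        l₂ : ∀ a y z s → a + (+ 1 + s) * y + s * (z - y) ≡ a + y + s * z
        l₂ = solve-∀
        cancel : ∀ a b c → a - b - a + c + b - c ≡ + 0
        cancel = solve-∀

      -- At k = s + 1 the formal size is -1 and the coefficient s - k + 1 is zero, so the six points
      -- again pair off with opposite signs. This second empty layer is what admits sizes two below
      -- a period.
      edges-1+s : edges (suc s) ≡ + 0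
      edges-1+s = trans
        (boundary-cong f (l₁ A′ e₂ e₁ e₃ (+ s)) (l₂ A′ e₁ e₃ (+ s)) (l₁ A′ e₁ e₂ e₃ (+ s)) (l₂ A′ e₂ e₃ (+ s)) (refl {x = p₅ (suc s)}) (refl {x = p₆ (suc s)}))
        (cancel (f (A′ + e₂ + S * e₃)) (f (A′ + S * e₃)) (f (A′ + e₁ + S * e₃)))
        where
        f = η₃ (suc s)
        l₁ : ∀ a x y z s → a + x + (+ 1 + s) * y + (+ 1 + s) * (z - y) ≡ a + x + (+ 1 + s) * z
        l₁ = solve-∀
        l₂ : ∀ a y z s → a + (+ 1 + s) * y + (+ 1 + s) * (z - y) ≡ a + (+ 1 + s) * z
        l₂ = solve-∀
        cancel : ∀ a b c → a - b - c + b + c - a ≡ + 0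
        cancel = solve-∀

      ∑-edges-s : N ≡ s ⊎ N ≡ 2 ℕ.+ s → ∑ s edges ≡ + 0
      ∑-edges-s (inj₁ refl) = ∑-edges
      ∑-edges-s (inj₂ refl) = begin
        ∑ s edges                                ≡⟨ lemma (∑ s edges) ⟩
        ∑ s edges + + 0 + + 0                    ≡⟨ cong₂ (λ x y → ∑ s edges + x + y) edges-s edges-1+s ⟨
        ∑ s edges + edges s + edges (suc s)      ≡⟨ cong (_+ edges (suc s)) (∑-last s edges) ⟨
        ∑ (suc s) edges + edges (suc s)          ≡⟨ ∑-last (suc s) edges ⟨
        ∑ (2 ℕ.+ s) edges                        ≡⟨ ∑-edges ⟩
        + 0                                      ∎
        where
        lemma : ∀ x → x ≡ x + + 0 + + 0
        lemma = solve-∀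

      scaled-triangle : ∀ k → k < s →
        + m * (+ m * (+ m * triangle (s ℕ.∸ k) (λ a b → θ k (A + + a * e₁ + + b * e₂ + + k * e₃)))) ≡ edges k
      scaled-triangle k k<s = begin
        + m * (+ m * (+ m * triangle n t))
          ≡⟨ cong (λ z → + m * (+ m * z)) (triangle-*ˡ n (+ m) t) ⟨
        + m * (+ m * triangle n (λ a b → + m * t a b))
          ≡⟨ cong (+ m *_) (triangle-*ˡ n (+ m) (λ a b → + m * t a b)) ⟨
        + m * triangle n (λ a b → + m * (+ m * t a b))
          ≡⟨ triangle-*ˡ n (+ m) (λ a b → + m * (+ m * t a b)) ⟨
        triangle n (λ a b → + m * (+ m * (+ m * t a b)))
          ≡⟨ triangle-cong n grid ⟨
        triangle n (vandermonde g)
          ≡⟨ triangle-vandermonde n g ⟩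
        g (suc n) 1 - g (suc n) 0 - g 1 (suc n) + g 0 (suc n) + g 1 0 - g 0 1
          ≡⟨ boundary-cong (η₃ k) (b₁ A′ (+ n) (+ k) e₁ e₂ e₃) (b₂ A′ (+ n) (+ k) e₁ e₂ e₃) (b₃ A′ (+ n) (+ k) e₁ e₂ e₃)
               (b₄ A′ (+ n) (+ k) e₁ e₂ e₃) (b₅ A′ (+ k) e₁ e₂ e₃) (b₆ A′ (+ k) e₁ e₂ e₃) ⟩
        boundary (η₃ k) (A′ + e₂ + S′ * e₁ + + k * (e₃ - e₁)) (A′ + S′ * e₁ + + k * (e₃ - e₁))
          (A′ + e₁ + S′ * e₂ + + k * (e₃ - e₂)) (A′ + S′ * e₂ + + k * (e₃ - e₂))
          (A′ + e₁ + + k * e₃) (A′ + e₂ + + k * e₃)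
          ≡⟨ cong (λ z → boundary (η₃ k) (A′ + e₂ + z * e₁ + + k * (e₃ - e₁)) (A′ + z * e₁ + + k * (e₃ - e₁))
              (A′ + e₁ + z * e₂ + + k * (e₃ - e₂)) (A′ + z * e₂ + + k * (e₃ - e₂))
              (A′ + e₁ + + k * e₃) (A′ + e₂ + + k * e₃)) (cong (λ z → + 1 + + z) (ℕ.m∸n+n≡m (ℕ.<⇒≤ k<s))) ⟩
        edges k ∎
        where
        n = s ℕ.∸ k
        S′ = + 1 + (+ n + + k)
        t : ℕ → ℕ → ℤ
        t a b = θ k (A + + a * e₁ + + b * e₂ + + k * e₃)
        g : ℕ → ℕ → ℤ
        g i j = η₃ k (A′ + + k * e₃ + + i * e₁ + + j * e₂)
        b₁ : ∀ A n k x y z → A + k * z + (+ 1 + n) * x + + 1 * y ≡ A + y + (+ 1 + (n + k)) * x + k * (z - x)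
        b₁ = solve-∀
        b₂ : ∀ A n k x y z → A + k * z + (+ 1 + n) * x + + 0 * y ≡ A + (+ 1 + (n + k)) * x + k * (z - x)
        b₂ = solve-∀
        b₃ : ∀ A n k x y z → A + k * z + + 1 * x + (+ 1 + n) * y ≡ A + x + (+ 1 + (n + k)) * y + k * (z - y)
        b₃ = solve-∀
        b₄ : ∀ A n k x y z → A + k * z + + 0 * x + (+ 1 + n) * y ≡ A + (+ 1 + (n + k)) * y + k * (z - y)
        b₄ = solve-∀
        b₅ : ∀ A k x y z → A + k * z + + 1 * x + + 0 * y ≡ A + x + k * z
        b₅ = solve-∀
        b₆ : ∀ A k x y z → A + k * z + + 0 * x + + 1 * y ≡ A + y + k * z
        b₆ = solve-∀
        grid : ∀ a b → vandermonde g a b ≡ + m * (+ m * (+ m * t a b))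
        grid a b = begin
          vandermonde g a b
            ≡⟨ boundary-cong (η₃ k) (c 2 1) (c 1 2) (c 2 0) (c 0 2) (c 1 0) (c 0 1) ⟩
          _ ≡⟨ vandermonde-antidifference k (A′ + + k * e₃ + + a * e₁ + + b * e₂) ⟩
          + m * (+ m * (+ m * θ k (A′ + + k * e₃ + + a * e₁ + + b * e₂ + e₂)))
            ≡⟨ cong (λ z → + m * (+ m * (+ m * θ k z))) (l A (+ k) (+ a) (+ b) e₁ e₂ e₃) ⟩
          + m * (+ m * (+ m * t a b)) ∎
          where
          l : ∀ A k a b x y z → A - y + k * z + a * x + b * y + y ≡ A + a * x + b * y + k * z
          l = solve-∀
          l′ : ∀ A k a b i j x y z → A + k * z + (i + a) * x + (j + b) * y ≡ A + k * z + a * x + b * y + i * x + j * y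
          l′ = solve-∀
          c : ∀ i j → A′ + + k * e₃ + + (i ℕ.+ a) * e₁ + + (j ℕ.+ b) * e₂
                    ≡ A′ + + k * e₃ + + a * e₁ + + b * e₂ + + i * e₁ + + j * e₂
          c i j = l′ A′ (+ k) (+ a) (+ b) (+ i) (+ j) e₁ e₂ e₃

    tetrahedron-null : N ≡ s ⊎ N ≡ 2 ℕ.+ s →
      tetrahedron-sum s (λ k a b → θ k (A + + a * e₁ + + b * e₂ + + k * e₃)) ≡ + 0
    tetrahedron-null N≡ = cancel (cancel (cancel (begin
      + m * (+ m * (+ m * ∑ s T))                  ≡⟨ cong (λ z → + m * (+ m * z)) (∑-*ˡ s (+ m) T) ⟨
      + m * (+ m * ∑ s (λ k → + m * T k))          ≡⟨ cong (+ m *_) (∑-*ˡ s (+ m) (λ k → + m * T k)) ⟨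
      + m * ∑ s (λ k → + m * (+ m * T k))          ≡⟨ ∑-*ˡ s (+ m) (λ k → + m * (+ m * T k)) ⟨
      ∑ s (λ k → + m * (+ m * (+ m * T k)))        ≡⟨ ∑-cong< s scaled-triangle ⟩
      ∑ s edges                                    ≡⟨ ∑-edges-s N≡ ⟩
      + 0                                          ∎)))
      where
      T : ℕ → ℤ
      T k = triangle (s ℕ.∸ k) (λ a b → θ k (A + + a * e₁ + + b * e₂ + + k * e₃))
      instance
        +m≢0 : ℤ.NonZero (+ m)
        +m≢0 = ℤ.≢-nonZero (ℕ.≢-nonZero⁻¹ m ∘ ℤ.+-injective)
      cancel : ∀ {x} → + m * x ≡ + 0 → x ≡ + 0
      cancel {x} eq = ℤ.*-cancelˡ-≡ (+ m) x (+ 0) (trans eq (sym (ℤ.*-zeroʳ (+ m))))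

-- Totals over the list of simplex points as iterated sums.

module _ {A : Set} (f : A → ℤ) (φ : ℤ → ℤ) where

  total-map-++ : ∀ xs ys → total (map f (xs ++ ys)) φ ≡ total (map f xs) φ + total (map f ys) φ
  total-map-++ []       ys = sym (ℤ.+-identityˡ (total (map f ys) φ))
  total-map-++ (x ∷ xs) ys =
    trans (cong (λ z → φ (f x) + z) (total-map-++ xs ys))
          (sym (ℤ.+-assoc (φ (f x)) (total (map f xs) φ) (total (map f ys) φ)))

  total-concatMap : ∀ (g : ℕ → List A) h n →
    total (map f (concatMap g (applyUpTo h n))) φ ≡ ∑ n (λ i → total (map f (g (h i))) φ)
  total-concatMap g h zero    = refl
  total-concatMap g h (suc n) =
    trans (total-map-++ (g (h 0)) (concatMap g (applyUpTo (h ∘ suc) n)))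
          (cong (λ z → total (map f (g (h 0))) φ + z) (total-concatMap g (h ∘ suc) n))

  total-map : ∀ (g : ℕ → A) h n → total (map f (map g (applyUpTo h n))) φ ≡ ∑ n (λ i → φ (f (g (h i))))
  total-map g h zero    = refl
  total-map g h (suc n) = cong (λ z → φ (f (g (h 0))) + z) (total-map g (h ∘ suc) n)

total-simplex : ∀ f φ s → total (map f (simplex s)) φ ≡ tetrahedron-sum s (λ a b c → φ (f (k3 a b c)))
total-simplex f φ s =
  trans (total-concatMap f φ (λ a → concatMap (λ b → map (k3 a b) (upTo (s ℕ.∸ a ℕ.∸ b))) (upTo (s ℕ.∸ a))) id s)
    (∑-cong s λ a → trans (total-concatMap f φ (λ b → map (k3 a b) (upTo (s ℕ.∸ a ℕ.∸ b))) id (s ℕ.∸ a))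
      (∑-cong (s ℕ.∸ a) λ b → total-map f φ (k3 a b) id (s ℕ.∸ a ℕ.∸ b)))

-- The bound on the last coordinate is kept because times are known to be nonnegative only within
-- the tetrahedron.
tetrahedron-cong< : ∀ s {f g} → (∀ a b c → c < s → f a b c ≡ g a b c) → tetrahedron-sum s f ≡ tetrahedron-sum s g
tetrahedron-cong< s f≡g = ∑-cong s λ a → ∑-cong (s ℕ.∸ a) λ b → ∑-cong< (s ℕ.∸ a ℕ.∸ b) λ c c< →
  f≡g a b c (ℕ.<-≤-trans c< (ℕ.≤-trans (ℕ.m∸n≤m (s ℕ.∸ a) b) (ℕ.m∸n≤m s a)))

tetrahedron-- : ∀ s f g →
  tetrahedron-sum s (λ a b c → f a b c - g a b c) ≡ tetrahedron-sum s f - tetrahedron-sum s g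
tetrahedron-- s f g = trans (∑-cong s λ a → triangle-- (s ℕ.∸ a) (f a) (g a))
  (∑-- s (λ a → triangle (s ℕ.∸ a) (f a)) (λ a → triangle (s ℕ.∸ a) (g a)))

-- Alternating sums over triangles and tetrahedra.

module Alternating (h : ℕ → ℤ) (alternates : ∀ n → h (suc n) ≡ - h n) where

  ∑-even : ∀ q → ∑ (q ℕ.* 2) h ≡ + 0
  ∑-even q = go q h alternates
    where
    lemma : ∀ x → x + (- x + + 0) ≡ + 0
    lemma = solve-∀
    go : ∀ q h → (∀ n → h (suc n) ≡ - h n) → ∑ (q ℕ.* 2) h ≡ + 0
    go zero    h alt = refl
    go (suc q) h alt =
      trans (cong₂ (λ x y → h 0 + (x + y)) (alt 0) (go q (h ∘ suc ∘ suc) (λ n → alt (2 ℕ.+ n)))) (lemma (h 0))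

  -- Below the first row lies a triangle of size n in which the index of h is raised by one, that
  -- is, in which h is negated.
  triangle-suc : ∀ n → triangle (suc n) (λ b c → h (b ℕ.+ c)) ≡ ∑ (suc n) h - triangle n (λ b c → h (b ℕ.+ c))
  triangle-suc n = cong (λ z → ∑ (suc n) h + z) (begin
    triangle n (λ b c → h (suc (b ℕ.+ c)))           ≡⟨ triangle-cong n (λ b c → trans (alternates (b ℕ.+ c)) (lemma (h (b ℕ.+ c)))) ⟩
    triangle n (λ b c → - + 1 * h (b ℕ.+ c))         ≡⟨ triangle-*ˡ n (- + 1) (λ b c → h (b ℕ.+ c)) ⟩
    - + 1 * triangle n (λ b c → h (b ℕ.+ c))         ≡⟨ lemma (triangle n (λ b c → h (b ℕ.+ c))) ⟨
    - triangle n (λ b c → h (b ℕ.+ c))               ∎)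
    where
    lemma : ∀ x → - x ≡ - + 1 * x
    lemma = solve-∀

  -- By `triangle-suc`, two layers of consecutive sizes n + 1 and n + 2 add up to an alternating sum
  -- of n + 2 terms, which vanishes for even n.
  tetrahedron-even : ∀ q → tetrahedron-sum (q ℕ.* 2) (λ a b c → h (b ℕ.+ c)) ≡ + 0
  tetrahedron-even zero    = refl
  tetrahedron-even (suc q) = begin
    t (2 ℕ.+ n) + (t (1 ℕ.+ n) + tetrahedron-sum n (λ a b c → h (b ℕ.+ c)))
      ≡⟨ cong₂ (λ x y → x + (t (1 ℕ.+ n) + y)) (triangle-suc (suc n)) (tetrahedron-even q) ⟩
    ∑ (2 ℕ.+ n) h - t (1 ℕ.+ n) + (t (1 ℕ.+ n) + + 0)
      ≡⟨ lemma (∑ (2 ℕ.+ n) h) (t (1 ℕ.+ n)) ⟩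
    ∑ (2 ℕ.+ n) h
      ≡⟨ ∑-even (suc q) ⟩
    + 0 ∎
    where
    n = q ℕ.* 2
    t : ℕ → ℤ
    t k = triangle k (λ b c → h (b ℕ.+ c))
    lemma : ∀ x y → x - y + (y + + 0) ≡ x
    lemma = solve-∀

-- Translation of twisted tetrahedra by 1 and by 2.

module _ (ρ A e₁ e₂ e₃ : ℤ) where

  twistedPoint : ℕ³ → ℤ
  twistedPoint (k3 a b c) = ρ ^ c * (A + + a * e₁ + + b * e₂ + + c * e₃)

  twistedTetrahedron : ℕ → List ℤ
  twistedTetrahedron s = map twistedPoint (simplex s)

  total-difference : ∀ s φ h → total (twistedTetrahedron s) (shift h φ) - total (twistedTetrahedron s) φ ≡
    tetrahedron-sum s (λ a b c → φ (twistedPoint (k3 a b c) + h) - φ (twistedPoint (k3 a b c)))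
  total-difference s φ h =
    trans (cong₂ _-_ (total-simplex twistedPoint (shift h φ) s) (total-simplex twistedPoint φ s))
          (sym (tetrahedron-- s (λ a b c → φ (twistedPoint (k3 a b c) + h)) (λ a b c → φ (twistedPoint (k3 a b c)))))

  -- Modulo 2 the point (a, b, c) is A + b + c. For a 2-periodic φ the difference φ(x + 1) - φ(x)
  -- changes sign when x grows by one, so the alternating sums apply.
  twistedTetrahedron-parity : ρ ≋ + 1 mod + 2 → e₁ ≋ + 0 mod + 2 → e₂ ≋ + 1 mod + 2 → e₃ ≋ + 1 mod + 2 →
    ∀ {s} → 2 ∣ s → Invariant (twistedTetrahedron s) (+ 2) (+ 1)
  twistedTetrahedron-parity ρ≋1 e₁≋0 e₂≋1 e₃≋1 (divides q refl) .invariance φ per =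
    ℤ.i-j≡0⇒i≡j _ _ (begin
      total (twistedTetrahedron (q ℕ.* 2)) (shift (+ 1) φ) - total (twistedTetrahedron (q ℕ.* 2)) φ
        ≡⟨ total-difference (q ℕ.* 2) φ (+ 1) ⟩
      tetrahedron-sum (q ℕ.* 2) (λ a b c → φ (twistedPoint (k3 a b c) + + 1) - φ (twistedPoint (k3 a b c)))
        ≡⟨ tetrahedron-cong< (q ℕ.* 2) (λ a b c _ → cong₂ _-_ (per (+-congʳ-mod (+ 1) (parity a b c))) (per (parity a b c))) ⟩
      tetrahedron-sum (q ℕ.* 2) (λ a b c → h (b ℕ.+ c))
        ≡⟨ Alternating.tetrahedron-even h alternates q ⟩
      + 0 ∎)
    where
    h : ℕ → ℤ
    h n = φ (A + + n + + 1) - φ (A + + n)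
    lemma₁ : ∀ A n → A + (+ 1 + n) + + 1 ≡ A + n + + 1 * + 2
    lemma₁ = solve-∀
    lemma₂ : ∀ A n → A + (+ 1 + n) ≡ A + n + + 1
    lemma₂ = solve-∀
    lemma₃ : ∀ x y → x - y ≡ - (y - x)
    lemma₃ = solve-∀
    alternates : ∀ n → h (suc n) ≡ - h n
    alternates n =
      trans (cong₂ _-_ (per (mod-by (+ 1) (lemma₁ A (+ n)))) (cong φ (lemma₂ A (+ n))))
            (lemma₃ (φ (A + + n)) (φ (A + + n + + 1)))
    lemma₄ : ∀ A a b c → + 1 * (A + a * + 0 + b * + 1 + c * + 1) ≡ A + (b + c)
    lemma₄ = solve-∀
    parity : ∀ a b c → twistedPoint (k3 a b c) ≋ A + + (b ℕ.+ c) mod + 2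
    parity a b c = *-cong-mod (^≋1 c ρ≋1)
      (+-cong-mod (+-cong-mod (+-congˡ-mod A (*-congˡ-mod (+ a) e₁≋0)) (*-congˡ-mod (+ b) e₂≋1)) (*-congˡ-mod (+ c) e₃≋1))
      ≋then≡ lemma₄ A (+ a) (+ b) (+ c)

  twistedTetrahedron-invariant-2 : ∀ {m N ρ⁻¹} .{{_ : NonZero m}} → ρ * ρ⁻¹ ≋ + 1 mod + m →
    (∀ B δ → DividesTwo (+ m) δ → Invariant (twistedLine ρ B δ N) (+ m) (+ 2)) →
    DividesTwo (+ m) e₁ → DividesTwo (+ m) e₂ → DividesTwo (+ m) e₃ →
    DividesTwo (+ m) (e₁ - e₂) → DividesTwo (+ m) (e₃ - e₁) → DividesTwo (+ m) (e₃ - e₂) →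
    ∀ {s} → N ≡ s ⊎ N ≡ 2 ℕ.+ s → Invariant (twistedTetrahedron s) (+ m) (+ 2)
  twistedTetrahedron-invariant-2 inv lines h₁ h₂ h₃ h₁₂ h₃₁ h₃₂ {s} N≡ .invariance φ per =
    ℤ.i-j≡0⇒i≡j _ _ (begin
      total (twistedTetrahedron s) (shift (+ 2) φ) - total (twistedTetrahedron s) φ
        ≡⟨ total-difference s φ (+ 2) ⟩
      tetrahedron-sum s (λ a b c → φ (twistedPoint (k3 a b c) + + 2) - φ (twistedPoint (k3 a b c)))
        ≡⟨ tetrahedron-rotate s (λ a b c → φ (twistedPoint (k3 a b c) + + 2) - φ (twistedPoint (k3 a b c))) ⟩
      tetrahedron-sum s (λ c a b → φ (twistedPoint (k3 a b c) + + 2) - φ (twistedPoint (k3 a b c)))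
        ≡⟨ tetrahedron-null (difference-null inv lines per) h₁ h₂ h₃ h₁₂ h₃₁ h₃₂ A s N≡ ⟩
      + 0 ∎)

-- From invariance to balance.

length-filter : ∀ {P : ℤ → Set} (P? : Decidable P) xs →
  + length (filter P? xs) ≡ total xs (λ x → if does (P? x) then + 1 else + 0)
length-filter P? []       = refl
length-filter P? (x ∷ xs) with does (P? x)
... | true  = cong (λ z → + 1 + z) (length-filter P? xs)
... | false = trans (length-filter P? xs) (sym (ℤ.+-identityˡ _))

indicator : (m : ℕ) .{{_ : NonZero m}} → ℕ → ℤ → ℤ
indicator m c x = if does ((x %ℕ m) ℕ.≟ c) then + 1 else + 0

indicator-periodic : ∀ m .{{_ : NonZero m}} c → Periodic (+ m) (indicator m c)
indicator-periodic m c x≋y = cong (λ r → if does (r ℕ.≟ c) then + 1 else + 0) (≋⇒%≡ m x≋y)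

indicator-shift : ∀ m .{{_ : NonZero m}} {c c′} → c < m → c′ < m →
  ∀ x → indicator m c (x + (+ c - + c′)) ≡ indicator m c′ x
indicator-shift m {c} {c′} c<m c′<m x =
  cong (if_then + 1 else + 0) (does-⇔ (mk⇔ to from) (((x + h) %ℕ m) ℕ.≟ c) ((x %ℕ m) ℕ.≟ c′))
  where
  h = + c - + c′
  lemma₁ : ∀ x a b → x ≡ x + (a - b) + (b - a)
  lemma₁ = solve-∀
  lemma₂ : ∀ a b → a + (b - a) ≡ b
  lemma₂ = solve-∀
  to : (x + h) %ℕ m ≡ c → x %ℕ m ≡ c′
  to eq = residue-unique (ℤ.n%ℕd<d x m) c′<m (≋-trans (≋-sym (≋-% x m))
    (lemma₁ x (+ c) (+ c′) ≡then≋ +-congʳ-mod (+ c′ - + c) (≋-% (x + h) m ≋then≡ cong +_ eq) ≋then≡ lemma₂ (+ c) (+ c′)))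
  from : x %ℕ m ≡ c′ → (x + h) %ℕ m ≡ c
  from eq = residue-unique (ℤ.n%ℕd<d (x + h) m) c<m (≋-trans (≋-sym (≋-% (x + h) m))
    (+-congʳ-mod h (≋-% x m ≋then≡ cong +_ eq) ≋then≡ lemma₂ (+ c′) (+ c)))

-- Multiplicities are totals of indicators of residue classes, and any two of these indicators are
-- translates of each other.
Invariant⇒Balanced : ∀ m .{{_ : NonZero m}} {xs} → Invariant xs (+ m) (+ 1) → Balanced m xs
Invariant⇒Balanced m {xs} inv c c′ = ℤ.+-injective (begin
  + mult m xs c                                     ≡⟨ length-filter (λ x → (x %ℕ m) ℕ.≟ toℕ c) xs ⟩
  total xs (indicator m (toℕ c))                    ≡⟨ invariance inv-h (indicator m (toℕ c)) (indicator-periodic m (toℕ c)) ⟨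
  total xs (shift h (indicator m (toℕ c)))          ≡⟨ total-cong xs (indicator-shift m (Fin.toℕ<n c) (Fin.toℕ<n c′)) ⟩
  total xs (indicator m (toℕ c′))                   ≡⟨ length-filter (λ x → (x %ℕ m) ℕ.≟ toℕ c′) xs ⟨
  + mult m xs c′                                    ∎)
  where
  h = + toℕ c - + toℕ c′
  -- The difference h may be negative; its residue is a natural number, hence reached by repeated
  -- translation by 1.
  inv-h : Invariant xs (+ m) h
  inv-h = Invariant-≋ (ℤ.*-identityʳ (+ (h %ℕ m)) ≡then≋ ≋-sym (≋-% h m)) (Invariant-multiple inv (h %ℕ m))

-- The orbit of an arithmetic array

listSum : {A : Set} → List A → (A → ℤ) → ℤ
listSum xs f = foldr _+_ (+ 0) (map f xs)

module _ {A : Set} where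

  listSum-cong-mod : ∀ {D} (xs : List A) {f g} → (∀ x → f x ≋ g x mod D) → listSum xs f ≋ listSum xs g mod D
  listSum-cong-mod []       f≋g = ≋-refl
  listSum-cong-mod (x ∷ xs) f≋g = +-cong-mod (f≋g x) (listSum-cong-mod xs f≋g)

  listSum-cong : ∀ (xs : List A) {f g} → (∀ x → f x ≡ g x) → listSum xs f ≡ listSum xs g
  listSum-cong []       f≡g = refl
  listSum-cong (x ∷ xs) f≡g = cong₂ _+_ (f≡g x) (listSum-cong xs f≡g)

  listSum-+ : ∀ (xs : List A) f g → listSum xs (λ x → f x + g x) ≡ listSum xs f + listSum xs g
  listSum-+ []       f g = refl
  listSum-+ (x ∷ xs) f g =
    trans (cong (λ z → f x + g x + z) (listSum-+ xs f g)) (+-interchange (f x) (g x) (listSum xs f) (listSum xs g))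

  listSum-* : ∀ (xs : List A) c f → listSum xs (λ x → c * f x) ≡ c * listSum xs f
  listSum-* []       c f = sym (ℤ.*-zeroʳ c)
  listSum-* (x ∷ xs) c f =
    trans (cong (λ z → c * f x + z) (listSum-* xs c f)) (sym (ℤ.*-distribˡ-+ c (f x) (listSum xs f)))

foldr-++ : ∀ xs ys → foldr _+_ (+ 0) (xs ++ ys) ≡ foldr _+_ (+ 0) xs + foldr _+_ (+ 0) ys
foldr-++ []       ys = sym (ℤ.+-identityˡ _)
foldr-++ (x ∷ xs) ys = trans (cong (λ z → x + z) (foldr-++ xs ys)) (sym (ℤ.+-assoc x _ _))

-- The flattened window sum becomes a nested one, so linearity and congruence can be proved for one
-- list at a time.
sumWin-listSum : ∀ r f → sumWin r f ≡ listSum (window r) (λ j₁ → listSum (window r) (f j₁))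
sumWin-listSum r f = go (window r)
  where
  go : ∀ js → foldr _+_ (+ 0) (concatMap (λ j₁ → map (f j₁) (window r)) js) ≡ listSum js (λ j₁ → listSum (window r) (f j₁))
  go []       = refl
  go (j ∷ js) = trans (foldr-++ (map (f j) (window r)) _) (cong (λ z → listSum (window r) (f j) + z) (go js))

module _ (r : ℕ) where

  sumWin-cong-mod : ∀ {D f g} → (∀ i j → f i j ≋ g i j mod D) → sumWin r f ≋ sumWin r g mod D
  sumWin-cong-mod {f = f} {g} f≋g =
    sumWin-listSum r f ≡then≋
      listSum-cong-mod (window r) (λ i → listSum-cong-mod (window r) (f≋g i))
      ≋then≡ sym (sumWin-listSum r g)

  sumWin-cong : ∀ {f g} → (∀ i j → f i j ≡ g i j) → sumWin r f ≡ sumWin r g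
  sumWin-cong {f} {g} f≡g = trans (sumWin-listSum r f)
    (trans (listSum-cong (window r) (λ i → listSum-cong (window r) (f≡g i))) (sym (sumWin-listSum r g)))

  sumWin-+ : ∀ f g → sumWin r (λ i j → f i j + g i j) ≡ sumWin r f + sumWin r g
  sumWin-+ f g = begin
    sumWin r (λ i j → f i j + g i j)
      ≡⟨ sumWin-listSum r (λ i j → f i j + g i j) ⟩
    listSum w (λ i → listSum w (λ j → f i j + g i j))
      ≡⟨ listSum-cong w (λ i → listSum-+ w (f i) (g i)) ⟩
    listSum w (λ i → listSum w (f i) + listSum w (g i))
      ≡⟨ listSum-+ w (λ i → listSum w (f i)) (λ i → listSum w (g i)) ⟩
    listSum w (λ i → listSum w (f i)) + listSum w (λ i → listSum w (g i))
      ≡⟨ cong₂ _+_ (sumWin-listSum r f) (sumWin-listSum r g) ⟨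
    sumWin r f + sumWin r g ∎
    where w = window r

  sumWin-* : ∀ c f → sumWin r (λ i j → c * f i j) ≡ c * sumWin r f
  sumWin-* c f = begin
    sumWin r (λ i j → c * f i j)                      ≡⟨ sumWin-listSum r (λ i j → c * f i j) ⟩
    listSum w (λ i → listSum w (λ j → c * f i j))     ≡⟨ listSum-cong w (λ i → listSum-* w c (f i)) ⟩
    listSum w (λ i → c * listSum w (f i))             ≡⟨ listSum-* w c (λ i → listSum w (f i)) ⟩
    c * listSum w (λ i → listSum w (f i))             ≡⟨ cong (c *_) (sumWin-listSum r f) ⟨
    c * sumWin r f                                    ∎
    where w = window r

module _ {m : ℤ} {r : ℕ} {W : Weights} {σ⁻¹ a d₁ d₂ : ℤ} (inverse : σ₀ r W * σ⁻¹ ≋ + 1 mod m) where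

  private
    σ d₃ : ℤ
    σ = σ₀ r W
    d₃ = σ⁻¹ * (σ₁ r W * d₁ + σ₂ r W * d₂)

  -- One step sends an affine array with value c at a point to the value σc + σ₁d₁ + σ₂d₂ there.
  -- Since σ₁d₁ + σ₂d₂ ≡ σd₃, this is σ(c + d₃): time acts as a third direction of step d₃.
  orbit-AA : ∀ t i₁ i₂ → orbit r W (AA a d₁ d₂) i₁ i₂ t ≋ σ ^ t * (a + i₁ * d₁ + i₂ * d₂ + + t * d₃) mod m
  orbit-AA zero i₁ i₂ = ≋-reflexive (lemma (a + i₁ * d₁ + i₂ * d₂) d₃)
    where
    lemma : ∀ x d → x ≡ + 1 * (x + + 0 * d)
    lemma = solve-∀
  orbit-AA (suc t) i₁ i₂ =
    ≋-trans (sumWin-cong-mod r (λ j₁ j₂ → *-congˡ-mod (W j₁ j₂) (orbit-AA t (i₁ + j₁) (i₂ + j₂))))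
      (linear ≡then≋ *-congˡ-mod (σ ^ t) (+-congˡ-mod (σ * c) σd₃)
        ≋then≡ lemma₃ (σ ^ t) σ (a + i₁ * d₁ + i₂ * d₂) (+ t) d₃)
    where
    c = a + i₁ * d₁ + i₂ * d₂ + + t * d₃
    lemma₁ : ∀ w p a i j x y t d → w * (p * (a + (i + x) * d₁ + (j + y) * d₂ + t * d))
      ≡ p * ((a + i * d₁ + j * d₂ + t * d) * w + (d₁ * (x * w) + d₂ * (y * w)))
    lemma₁ w p a i j x y t d = general w p a i j x y t d d₁ d₂
      where
      general : ∀ w p a i j x y t d u v → w * (p * (a + (i + x) * u + (j + y) * v + t * d))
        ≡ p * ((a + i * u + j * v + t * d) * w + (u * (x * w) + v * (y * w)))
      general = solve-∀
    lemma₂ : ∀ c s x y u v → c * s + (u * x + v * y) ≡ s * c + (x * u + y * v)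
    lemma₂ = solve-∀
    lemma₃ : ∀ p s x t d → p * (s * (x + t * d) + s * d) ≡ s * p * (x + (+ 1 + t) * d)
    lemma₃ = solve-∀
    lemma₄ : ∀ x → x ≡ + 1 * x
    lemma₄ = solve-∀
    σd₃ : σ₁ r W * d₁ + σ₂ r W * d₂ ≋ σ * d₃ mod m
    σd₃ = lemma₄ (σ₁ r W * d₁ + σ₂ r W * d₂) ≡then≋
      *-congʳ-mod (σ₁ r W * d₁ + σ₂ r W * d₂) (≋-sym inverse)
      ≋then≡ ℤ.*-assoc σ σ⁻¹ (σ₁ r W * d₁ + σ₂ r W * d₂)
    w₁ w₂ : ℤ → ℤ → ℤ
    w₁ j₁ j₂ = j₁ * W j₁ j₂
    w₂ j₁ j₂ = j₂ * W j₁ j₂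
    linear : sumWin r (λ j₁ j₂ → W j₁ j₂ * (σ ^ t * (a + (i₁ + j₁) * d₁ + (i₂ + j₂) * d₂ + + t * d₃)))
      ≡ σ ^ t * (σ * c + (σ₁ r W * d₁ + σ₂ r W * d₂))
    linear = begin
      _ ≡⟨ sumWin-cong r (λ j₁ j₂ → lemma₁ (W j₁ j₂) (σ ^ t) a i₁ i₂ j₁ j₂ (+ t) d₃) ⟩
      sumWin r (λ j₁ j₂ → σ ^ t * (c * W j₁ j₂ + (d₁ * w₁ j₁ j₂ + d₂ * w₂ j₁ j₂)))
        ≡⟨ sumWin-* r (σ ^ t) (λ j₁ j₂ → c * W j₁ j₂ + (d₁ * w₁ j₁ j₂ + d₂ * w₂ j₁ j₂)) ⟩
      σ ^ t * sumWin r (λ j₁ j₂ → c * W j₁ j₂ + (d₁ * w₁ j₁ j₂ + d₂ * w₂ j₁ j₂))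
        ≡⟨ cong (σ ^ t *_) (begin
          sumWin r (λ j₁ j₂ → c * W j₁ j₂ + (d₁ * w₁ j₁ j₂ + d₂ * w₂ j₁ j₂))
            ≡⟨ sumWin-+ r (λ j₁ j₂ → c * W j₁ j₂) (λ j₁ j₂ → d₁ * w₁ j₁ j₂ + d₂ * w₂ j₁ j₂) ⟩
          sumWin r (λ j₁ j₂ → c * W j₁ j₂) + sumWin r (λ j₁ j₂ → d₁ * w₁ j₁ j₂ + d₂ * w₂ j₁ j₂)
            ≡⟨ cong₂ _+_ (sumWin-* r c W) (sumWin-+ r (λ j₁ j₂ → d₁ * w₁ j₁ j₂) (λ j₁ j₂ → d₂ * w₂ j₁ j₂)) ⟩
          c * σ + (sumWin r (λ j₁ j₂ → d₁ * w₁ j₁ j₂) + sumWin r (λ j₁ j₂ → d₂ * w₂ j₁ j₂))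
            ≡⟨ cong (λ z → c * σ + z) (cong₂ _+_ (sumWin-* r d₁ w₁) (sumWin-* r d₂ w₂)) ⟩
          c * σ + (d₁ * σ₁ r W + d₂ * σ₂ r W)
            ≡⟨ lemma₂ c σ (σ₁ r W) (σ₂ r W) d₁ d₂ ⟩
          σ * c + (σ₁ r W * d₁ + σ₂ r W * d₂) ∎) ⟩
      σ ^ t * (σ * c + (σ₁ r W * d₁ + σ₂ r W * d₂)) ∎

-- Arithmetic hypotheses in terms of congruences.

fromDefs : ∀ {x m y} → x ≡[ m ] y → x ≋ y mod + m
fromDefs {x} {m} {y} m∣x-y with Signed.divides q eq ← Signed.∣ᵤ⇒∣ {+ m} {x - y} m∣x-y =
  mod-by q (trans (lemma x y) (cong (λ z → y + z) eq))
  where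
  lemma : ∀ x y → x ≡ y + (x - y)
  lemma = solve-∀

∣⇒≋0 : ∀ {d n} → d ∣ n → + n ≋ + 0 mod + d
∣⇒≋0 {d} (divides q refl) = ℤ.pos-* q d ≡then≋ multiple≋0 (+ q)

≋-∣ : ∀ {d m x y} → d ∣ m → x ≋ y mod + m → x ≋ y mod + d
≋-∣ {d} {x = x} {y} (divides q refl) = ≋-divisor {q = + q} ∘ subst (x ≋ y mod_) (ℤ.pos-* q d)

Invertible⇒DividesTwo : ∀ {m x} → Invertible m x → DividesTwo (+ m) x
Invertible⇒DividesTwo {m} {x} (y , xy) =
  + 2 * y , (lemma x y ≡then≋ *-congˡ-mod (+ 2) (fromDefs {x * y} {m} {+ 1} xy))
  where
  lemma : ∀ x y → + 2 * y * x ≡ + 2 * (x * y)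
  lemma = solve-∀

-- The integer gcd is that of absolute values; a negative x is accounted for by the sign of the
-- Bézout coefficient.
abs-multiple : ∀ x z → ∃ λ g → g * x ≡ z * + ℤ.∣ x ∣
abs-multiple (+ n)      z = z , refl
abs-multiple (ℤ.-[1+ n ]) z = - z , lemma z (+ suc n)
  where
  lemma : ∀ z y → - z * - y ≡ z * y
  lemma = solve-∀

gcd≡2⇒DividesTwo : ∀ {m x} → ℤG.gcd x (+ m) ≡ + 2 → DividesTwo (+ m) x
gcd≡2⇒DividesTwo {m} {x} gcd≡2
  with z , gcd≋ ← bezout ℤ.∣ x ∣ m
  with g , gx ← abs-multiple x z = g , (gx ≡then≋ ≋-sym gcd≋ ≋then≡ gcd≡2)

gcd≡2⇒even : ∀ {m x} → ℤG.gcd x (+ m) ≡ + 2 → x ≋ + 0 mod + 2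
gcd≡2⇒even {m} {x} gcd≡2
  with Signed.divides q eq ← Signed.∣ᵤ⇒∣ {+ 2} {x} (subst (λ d → ℤ.∣ d ∣ ∣ ℤ.∣ x ∣) gcd≡2 (ℤG.gcd[i,j]∣i x (+ m))) =
  eq ≡then≋ multiple≋0 q

unit-odd : ∀ {x y} → x * y ≋ + 1 mod + 2 → x ≋ + 1 mod + 2
unit-odd {x} {y} xy≋1 = residue (x %ℕ 2) (≋-% x 2) (ℤ.n%ℕd<d x 2)
  where
  residue : ∀ r → x ≋ + r mod + 2 → r < 2 → x ≋ + 1 mod + 2
  residue 0 x≋0 _ = contradiction (1≋0⇒≡1 (≋-trans (≋-sym xy≋1) (*-congʳ-mod y x≋0))) λ ()
  residue 1 x≋1 _ = x≋1
  residue (suc (suc _)) _ (ℕ.s<s (ℕ.s<s ()))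

pos-^ : ∀ b k → + (b ℕ.^ k) ≡ (+ b) ^ k
pos-^ b zero    = refl
pos-^ b (suc k) = trans (ℤ.pos-* b (b ℕ.^ k)) (cong (+ b *_) (pos-^ b k))

-- For n = 1 + 2h the inverse of 2 is -h.
odd⇒2-invertible : ∀ n → ¬ (2 ∣ n) → ∃ λ w → w * + 2 ≋ + 1 mod + n
odd⇒2-invertible n 2∤n with n ℕ.% 2 in r | ℕ.m≡m%n+[m/n]*n n 2 | ℕ.m%n<n n 2
... | 0 | _  | _ = ⊥-elim (2∤n (ℕ.m%n≡0⇒n∣m n 2 r))
... | 1 | eq | _ = - (+ (n ℕ./ 2)) , mod-by (- (+ 1)) (begin
  - h * + 2                      ≡⟨ lemma h ⟩
  + 1 + - + 1 * (+ 1 + h * + 2)  ≡⟨ cong (λ z → + 1 + - + 1 * (+ 1 + z)) (ℤ.pos-* (n ℕ./ 2) 2) ⟨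
  + 1 + - + 1 * + (1 ℕ.+ n ℕ./ 2 ℕ.* 2)  ≡⟨ cong (λ z → + 1 + - + 1 * + z) eq ⟨
  + 1 + - + 1 * + n              ∎)
  where
  h = + (n ℕ./ 2)
  lemma : ∀ h → - h * + 2 ≡ + 1 + - + 1 * (+ 1 + h * + 2)
  lemma = solve-∀
... | suc (suc _) | _ | ℕ.s<s (ℕ.s<s ())

-- Here m = 2ᵘn, with n odd by maximality of u and with u positive because m is even. So 2ᵘ = 2 · 2ᵛ
-- has the form required for the descent, and the u-th power of an inverse of 2 inverts it modulo n.
twistedLine-invariant-2 : ∀ {m u} .{{_ : NonZero m}} → 2 ∣ m → IsV2 m u →
  ∀ {ρ ρ⁻¹ N} .{{_ : NonZero N}} → ρ ≋ + 1 mod + (2 ℕ.^ u) → ρ * ρ⁻¹ ≋ + 1 mod + m →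
  ρ ^ N ≋ + 1 mod + m → + N ≋ + 0 mod + m →
  ∀ B δ → DividesTwo (+ m) δ → Invariant (twistedLine ρ B δ N) (+ m) (+ 2)
twistedLine-invariant-2 {u = zero} 2∣m (_ , 2∤m) _ _ _ _ = ⊥-elim (2∤m 2∣m)
twistedLine-invariant-2 {m} {u@(suc v)} 2∣m (divides n m≡ , 2ᵘ⁺¹∤m) {ρ} {ρ⁻¹} {N} ρ≋1 inv ρᴺ N≋0 B δ (g , gδ) =
  let w , w2≋1 = odd⇒2-invertible n odd in
  subst (λ D → Invariant (twistedLine ρ B δ N) D (+ 2)) (sym m≡Un)
    (twistedLine-invariant-2-coprime {V = (+ 2) ^ v} {w ^ u} {ρ} {ρ⁻¹} {B} {δ} {g} n (<-wellFounded n)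
      (^-inverse {ρ = w} {+ 2} w2≋1 u) (subst (ρ ≋ + 1 mod_) (pos-^ 2 u) ρ≋1) (cast inv) (cast gδ) (cast ρᴺ) (cast N≋0))
  where
  instance
    n≢0 : NonZero n
    n≢0 = ℕ.≢-nonZero λ { refl → ℕ.≢-nonZero⁻¹ m m≡ }
  odd : ¬ (2 ∣ n)
  odd (divides q n≡q*2) = 2ᵘ⁺¹∤m (divides q (trans m≡ (trans (cong (ℕ._* 2 ℕ.^ u) n≡q*2) (ℕ.*-assoc q 2 (2 ℕ.^ u)))))
  m≡Un : + m ≡ (+ 2) ^ u * + n
  m≡Un = trans (cong +_ (trans m≡ (ℕ.*-comm n (2 ℕ.^ u))))
    (trans (ℤ.pos-* (2 ℕ.^ u) n) (cong (_* + n) (pos-^ 2 u)))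
  cast : ∀ {x y} → x ≋ y mod + m → x ≋ y mod ((+ 2) ^ u * + n)
  cast {x} {y} = subst (x ≋ y mod_) m≡Un

inverse-^≋1 : ∀ {D x y} n → x * y ≋ + 1 mod D → x ^ n ≋ + 1 mod D → y ^ n ≋ + 1 mod D
inverse-^≋1 {x = x} {y} n xy xⁿ =
  sym (ℤ.*-identityˡ (y ^ n)) ≡then≋ ≋-trans (*-congʳ-mod (y ^ n) (≋-sym xⁿ)) (^-inverse xy n)

^-∣ : ∀ {D x o N} → x ^ o ≋ + 1 mod D → o ∣ N → x ^ N ≋ + 1 mod D
^-∣ {x = x} {o} xᵒ (divides q refl) =
  trans (cong (x ^_) (ℕ.*-comm q o)) (sym (ℤ.^-*-assoc x o q)) ≡then≋ ^≋1 q xᵒ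

-- The multiplier of one step in the time direction: σ forwards and σ⁻¹ backwards.
record TimeStep (m : ℕ) (σ ε : ℤ) : Set where
  field
    ρ ρ⁻¹     : ℤ
    inverse   : ρ * ρ⁻¹ ≋ + 1 mod + m
    power≋1   : ∀ {d} n → d ∣ m → σ ^ n ≋ + 1 mod + d → ρ ^ n ≋ + 1 mod + d
    advance   : ∀ {t c n} → + n ≡ + t + ε * + c → σ ^ n ≋ σ ^ t * ρ ^ c mod + m

timeStep : ∀ {m σ σ⁻¹ ε} → σ * σ⁻¹ ≋ + 1 mod + m → IsSign ε → TimeStep m σ ε
timeStep {m} {σ} {σ⁻¹} inv (inj₁ refl) = record
  { ρ = σ ; ρ⁻¹ = σ⁻¹ ; inverse = inv
  ; power≋1 = λ _ _ σⁿ → σⁿ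
  ; advance = λ {t} {c} n≡ → cong (σ ^_) (ℤ.+-injective (trans n≡ (cong (λ z → + t + z) (ℤ.*-identityˡ (+ c)))))
      ≡then≋ ≋-reflexive (ℤ.^-distribˡ-+-* σ t c)
  }
timeStep {m} {σ} {σ⁻¹} inv (inj₂ refl) = record
  { ρ = σ⁻¹ ; ρ⁻¹ = σ ; inverse = ℤ.*-comm σ⁻¹ σ ≡then≋ inv
  ; power≋1 = λ n d∣m σⁿ → inverse-^≋1 n (≋-∣ d∣m inv) σⁿ
  -- Backwards in time n + c = t, so σⁿ ≡ σⁿσᶜ(σ⁻¹)ᶜ = σᵗ(σ⁻¹)ᶜ.
  ; advance = λ {t} {c} {n} n≡ → lemma₁ (σ ^ n) ≡then≋
      ≋-trans (*-congˡ-mod (σ ^ n) (≋-sym (^-inverse inv c)))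
        (≋-reflexive (trans (sym (ℤ.*-assoc (σ ^ n) (σ ^ c) (σ⁻¹ ^ c)))
          (cong (_* σ⁻¹ ^ c) (trans (sym (ℤ.^-distribˡ-+-* σ n c)) (cong (σ ^_) (n+c≡t n≡))))))
  }
  where
  lemma₁ : ∀ x → x ≡ x * + 1
  lemma₁ = solve-∀
  lemma₂ : ∀ t c → t + - + 1 * c + c ≡ t
  lemma₂ = solve-∀
  n+c≡t : ∀ {n c t} → + n ≡ + t + - + 1 * + c → n ℕ.+ c ≡ t
  n+c≡t {c = c} {t} n≡ = ℤ.+-injective (trans (cong (_+ + c) n≡) (lemma₂ (+ t) (+ c)))

-- Tetrahedra of the orbit as twisted tetrahedra modulo m.

theorem4p5 : (m : ℕ) .{{_ : NonZero m}} → 2 ∣ m → ¬ (3 ∣ m)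
    → (r : ℕ) (W : Weights)
    → (σinv : ℤ) → (σ₀ r W * σinv) ≡[ m ] (+ 1)
    → (u : ℕ) → IsV2 m u → σ₀ r W ≡[ 2 ℕ.^ u ] (+ 1)
    → (o : ℕ) → IsOrd m (σ₀ r W) o
    → (a d₁ d₂ ε₁ ε₂ ε₃ : ℤ) → IsSign ε₁ → IsSign ε₂ → IsSign ε₃
    → let d₃ = σinv * (σ₁ r W * d₁ + σ₂ r W * d₂) in
    Invertible m (ε₂ * d₂) → Invertible m (ε₃ * d₃)
    → Invertible m (ε₂ * d₂ - ε₁ * d₁) → Invertible m (ε₁ * d₁ - ε₃ * d₃)
    → ℤG.gcd (ε₁ * d₁) (+ m) ≡ + 2 → ℤG.gcd (ε₃ * d₃ - ε₂ * d₂) (+ m) ≡ + 2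
    → (s : ℕ) → 0 < s → (lcm o m ∣ s ⊎ lcm o m ∣ s ℕ.+ 2)
    → (j₁ j₂ : ℤ) (t : ℕ) → InArray ε₃ t s
    → Balanced m (tetrahedron r W (AA a d₁ d₂) ε₁ ε₂ ε₃ j₁ j₂ t s)
theorem4p5 m 2∣m _ r W σ⁻¹ σσ⁻¹ u v2 σ≡1 o (0<o , σᵒ , _) a d₁ d₂ ε₁ ε₂ ε₃ _ _ sign₃
  unit₂ unit₃ unit₂₁ unit₁₃ gcd₁ gcd₃₂ s 0<s o,m∣ j₁ j₂ t inArray =
  Invariant⇒Balanced m {tetra} λ where
    .invariance φ per → begin
      total tetra (shift (+ 1) φ)      ≡⟨ total-tetra (shift (+ 1) φ) (shift-periodic (+ 1) per) ⟩
      total twisted (shift (+ 1) φ)    ≡⟨ invariance (twisted-invariant (size o,m∣)) φ per ⟩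
      total twisted φ                  ≡⟨ total-tetra φ per ⟨
      total tetra φ                    ∎
  where
  σ = σ₀ r W
  d₃ = σ⁻¹ * (σ₁ r W * d₁ + σ₂ r W * d₂)
  σ-inv : σ * σ⁻¹ ≋ + 1 mod + m
  σ-inv = fromDefs {σ * σ⁻¹} {m} {+ 1} σσ⁻¹
  open TimeStep (timeStep {m} {σ} {σ⁻¹} {ε₃} σ-inv sign₃)
  A e₁ e₂ e₃ : ℤ
  A  = σ ^ t * (a + j₁ * d₁ + j₂ * d₂ + + t * d₃)
  e₁ = σ ^ t * (ε₁ * d₁)
  e₂ = σ ^ t * (ε₂ * d₂)
  e₃ = σ ^ t * (ε₃ * d₃)
  tetra = tetrahedron r W (AA a d₁ d₂) ε₁ ε₂ ε₃ j₁ j₂ t s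
  twisted = twistedTetrahedron ρ A e₁ e₂ e₃ s

  point : ∀ i j k → k < s →
    orbit r W (AA a d₁ d₂) (j₁ + ε₁ * + i) (j₂ + ε₂ * + j) ℤ.∣ + t + ε₃ * + k ∣
      ≋ twistedPoint ρ A e₁ e₂ e₃ (k3 i j k) mod + m
  point i j k k<s = ≋-trans (orbit-AA {r = r} {W} {σ⁻¹} {a} {d₁} {d₂} σ-inv n (j₁ + ε₁ * + i) (j₂ + ε₂ * + j))
    (≋-trans (*-congʳ-mod (a + (j₁ + ε₁ * + i) * d₁ + (j₂ + ε₂ * + j) * d₂ + + n * d₃) (advance {t} {k} n≡))
      (≋-reflexive (trans (cong (λ z → σ ^ t * ρ ^ k * (a + (j₁ + ε₁ * + i) * d₁ + (j₂ + ε₂ * + j) * d₂ + z * d₃)) n≡)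
        (lemma (σ ^ t) (ρ ^ k) a j₁ j₂ (+ t) ε₁ ε₂ ε₃ d₁ d₂ d₃ (+ i) (+ j) (+ k)))))
    where
    n = ℤ.∣ + t + ε₃ * + k ∣
    n≡ : + n ≡ + t + ε₃ * + k
    n≡ = ℤ.0≤i⇒+∣i∣≡i (inArray k k<s)
    lemma : ∀ p q a x y t ε₁ ε₂ ε₃ d₁ d₂ d₃ i j k →
      p * q * (a + (x + ε₁ * i) * d₁ + (y + ε₂ * j) * d₂ + (t + ε₃ * k) * d₃)
        ≡ q * (p * (a + x * d₁ + y * d₂ + t * d₃) + i * (p * (ε₁ * d₁)) + j * (p * (ε₂ * d₂)) + k * (p * (ε₃ * d₃)))
    lemma = solve-∀

  total-tetra : ∀ φ → Periodic (+ m) φ → total tetra φ ≡ total twisted φ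
  total-tetra φ per =
    trans (total-simplex (λ k → orbit r W (AA a d₁ d₂) (j₁ + ε₁ * + ℕ³.k₁ k) (j₂ + ε₂ * + ℕ³.k₂ k) ℤ.∣ + t + ε₃ * + ℕ³.k₃ k ∣) φ s)
      (trans (tetrahedron-cong< s λ i j k k<s → per (point i j k k<s))
        (sym (total-simplex (twistedPoint ρ A e₁ e₂ e₃) φ s)))

  unit⇒odd : ∀ {x} → Invertible m x → x ≋ + 1 mod + 2
  unit⇒odd {x} (y , xy) = unit-odd {y = y} (≋-∣ 2∣m (fromDefs {x * y} {m} {+ 1} xy))

  σᵗ-odd : σ ^ t ≋ + 1 mod + 2
  σᵗ-odd = ^≋1 t (unit-odd {y = σ⁻¹} (≋-∣ 2∣m σ-inv))

  σᵗ-unit : σ ^ t * σ⁻¹ ^ t ≋ + 1 mod + m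
  σᵗ-unit = ^-inverse σ-inv t

  scaled : ∀ {x} → DividesTwo (+ m) x → DividesTwo (+ m) (σ ^ t * x)
  scaled {x} = DividesTwo-*-unit {+ m} {x} {σ ^ t} {σ⁻¹ ^ t} σᵗ-unit

  scaled-difference : ∀ {x y} → DividesTwo (+ m) (x - y) → DividesTwo (+ m) (σ ^ t * x - σ ^ t * y)
  scaled-difference {x} {y} h = subst (DividesTwo (+ m)) (lemma (σ ^ t) x y) (scaled {x - y} h)
    where
    lemma : ∀ c x y → c * (x - y) ≡ c * x - c * y
    lemma = solve-∀

  size : lcm o m ∣ s ⊎ lcm o m ∣ s ℕ.+ 2 → ∃ λ N → 0 < N × lcm o m ∣ N × (N ≡ s ⊎ N ≡ 2 ℕ.+ s)
  size (inj₁ ∣s)   = s , 0<s , ∣s , inj₁ refl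
  size (inj₂ ∣s+2) = 2 ℕ.+ s , ℕ.z<s , subst (lcm o m ∣_) (ℕ.+-comm s 2) ∣s+2 , inj₂ refl

  2∣s : ∀ {N} → m ∣ N → N ≡ s ⊎ N ≡ 2 ℕ.+ s → 2 ∣ s
  2∣s m∣N (inj₁ refl) = ℕ.∣-trans 2∣m m∣N
  2∣s m∣N (inj₂ refl) = ℕ.∣m+n∣m⇒∣n (ℕ.∣-trans 2∣m m∣N) ℕ.∣-refl

  ρ≋1 : ρ ≋ + 1 mod + (2 ℕ.^ u)
  ρ≋1 = sym (ℤ.*-identityʳ ρ) ≡then≋ power≋1 1 (proj₁ v2)
    (ℤ.*-identityʳ σ ≡then≋ fromDefs {σ} {2 ℕ.^ u} {+ 1} σ≡1)

  twisted-invariant : (∃ λ N → 0 < N × lcm o m ∣ N × (N ≡ s ⊎ N ≡ 2 ℕ.+ s)) → Invariant twisted (+ m) (+ 1)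
  twisted-invariant (N , 0<N , o,m∣N , N≡) =
    -- The m translates by multiples of 2 meet every even residue twice, which is harmless in an
    -- average and avoids halving m.
    Invariant-average m (ℤ.*-comm (+ m) (+ 2) ≡then≋ multiple≋0 (+ 2))
      (twistedTetrahedron-invariant-2 ρ A e₁ e₂ e₃ inverse lines
        (scaled (gcd≡2⇒DividesTwo gcd₁)) (scaled (Invertible⇒DividesTwo unit₂)) (scaled (Invertible⇒DividesTwo unit₃))
        (scaled-difference (DividesTwo-neg {x = ε₂ * d₂} (Invertible⇒DividesTwo unit₂₁)))
        (scaled-difference (DividesTwo-neg {x = ε₁ * d₁} (Invertible⇒DividesTwo unit₁₃)))
        (scaled-difference (gcd≡2⇒DividesTwo gcd₃₂)) N≡)
      (twistedTetrahedron-parity ρ A e₁ e₂ e₃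
        (unit-odd {y = ρ⁻¹} (≋-∣ 2∣m inverse))
        (*-congˡ-mod (σ ^ t) (gcd≡2⇒even {m} gcd₁) ≋then≡ ℤ.*-zeroʳ (σ ^ t))
        (*-cong-mod σᵗ-odd (unit⇒odd unit₂)) (*-cong-mod σᵗ-odd (unit⇒odd unit₃))
        (2∣s m∣N N≡))
    where
    instance
      N≢0 : NonZero N
      N≢0 = ℕ.>-nonZero 0<N
    m∣N : m ∣ N
    m∣N = ℕ.∣-trans (n∣lcm[m,n] o m) o,m∣N
    σᴺ : σ ^ N ≋ + 1 mod + m
    σᴺ = ^-∣ (fromDefs {σ ^ o} {m} {+ 1} σᵒ) (ℕ.∣-trans (m∣lcm[m,n] o m) o,m∣N)
    lines : ∀ B δ → DividesTwo (+ m) δ → Invariant (twistedLine ρ B δ N) (+ m) (+ 2)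
    lines = twistedLine-invariant-2 {m} {u} 2∣m v2 {ρ} {ρ⁻¹} {N} ρ≋1 inverse
      (power≋1 N ℕ.∣-refl σᴺ) (∣⇒≋0 m∣N)
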